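{- Let $0<k<n$, and let $A\in\mathbb{Z}^{k\times n}$ and $B\in\mathbb{Z}^{(n-k)\times n}$ be integer matrices of full row rank such that $A B^T=0$. Then \[ \operatorname{ndet}(L_R(A))=\operatorname{ndet}(L_R(B)), \] that is, \[ \frac{\sqrt{\det(AA^T)}}{\det(L_C(A))}=\frac{\sqrt{\det(BB^T)}}{\det(L_C(B))}. \]
   Context: For an integer matrix $M\in\mathbb{Z}^{m\times n}$, $L_R(M)\subseteq\mathbb{Z}^n$ denotes the lattice generated by the rows of $M$ and $L_C(M)\subseteq\mathbb{Z}^m$ the lattice generated by the columns of $M$. For a lattice $L$ with basis matrix $V$ (a matrix whose rows form a $\mathbb{Z}$-basis of $L$), $\det(L)=\sqrt{\det(VV^T)}$, independent of the choice of basis. For a lattice $\Lambda$ with basis matrix $M$ of full row rank, the normalized determinant is $\operatorname{ndet}(\Lambda)=\det(L_R(M))/\det(L_C(M))$. -}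

module Defs where

open import Algebra.Properties.Semiring.Sum using () renaming (sum to sumOf)
open import Data.Fin.Base using (Fin; zero; suc; punchIn)
open import Data.Integer.Base as ℤ using (ℤ; +_; -[1+_]; 0ℤ; 1ℤ)
import Data.Integer.Properties as ℤ
import Data.Integer.Tactic.RingSolver as ℤSolver
open import Data.Nat.Base as ℕ using (ℕ; zero; suc; z≤n; s≤s)
import Data.Nat.Properties as ℕ
open import Data.Nat.Tactic.RingSolver using (solve-∀)
open import Data.Product.Base using (Σ-syntax; ∃; ∃-syntax; _×_; _,_; proj₁; proj₂)
open import Data.Rational.Base as ℚ using (ℚ; 0ℚ; 1ℚ)
import Data.Rational.Properties as ℚ
open import Data.Rational.Solver using (module +-*-Solver)
open import Data.Rational.Unnormalised.Base as ℚᵘ using (mkℚᵘ)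
import Data.Rational.Unnormalised.Properties as ℚᵘ
open import Data.Sum.Base using (inj₁; inj₂; [_,_]′)
open import Data.Vec.Functional using (Vector)
open import Function.Bundles using (_⇔_)
open import Level using (0ℓ)
open import Relation.Binary.PropositionalEquality
  using (_≡_; refl; sym; trans; cong; cong₂; subst; module ≡-Reasoning)
open import Relation.Nullary using (yes; no; contradiction)
open import Relation.Unary using (Pred; _∈_)

------------------------------------------------------------------------
-- Real numbers: Cauchy sequences of rationals, equal when their
-- difference tends to 0.

IsCauchy : (ℕ → ℚ) → Set
IsCauchy x = ∀ ε → 0ℚ ℚ.< ε →
  ∃[ N ] (∀ m n → N ℕ.≤ m → N ℕ.≤ n → ℚ.∣ x m ℚ.- x n ∣ ℚ.≤ ε)

record ℝ : Set where
  constructor mkℝ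
  field
    seq    : ℕ → ℚ
    cauchy : IsCauchy seq

open ℝ public

infix 4 _≈_ _#0

_≈_ : ℝ → ℝ → Set
x ≈ y = ∀ ε → 0ℚ ℚ.< ε →
  ∃[ N ] (∀ n → N ℕ.≤ n → ℚ.∣ seq x n ℚ.- seq y n ∣ ℚ.≤ ε)

-- The constructive form of x ≠ 0: the terms are eventually bounded away
-- from 0.  This is what is needed to invert x.
_#0 : ℝ → Set
x #0 = ∃[ δ ] 0ℚ ℚ.< δ × ∃[ N ] (∀ n → N ℕ.≤ n → δ ℚ.≤ ℚ.∣ seq x n ∣)

open +-*-Solver using (solve; _:=_; _:+_; _:*_; _:-_; :-_)

x[yz]≡y[xz] : ∀ x y z → x ℚ.* (y ℚ.* z) ≡ y ℚ.* (x ℚ.* z)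
x[yz]≡y[xz] = solve 3 (λ x y z → x :* (y :* z) := y :* (x :* z)) refl

p≡p-q+q : ∀ p q → p ≡ (p ℚ.- q) ℚ.+ q
p≡p-q+q = solve 2 (λ p q → p := (p :- q) :+ q) refl

p+q-p≡q : ∀ p q → (p ℚ.+ q) ℚ.- p ≡ q
p+q-p≡q = solve 2 (λ p q → (p :+ q) :- p := q) refl

neg-flip : ∀ p q → ℚ.- (p ℚ.- q) ≡ q ℚ.- p
neg-flip = solve 2 (λ p q → :- (p :- q) := q :- p) refl

*-difference : ∀ a b c d → a ℚ.* b ℚ.- c ℚ.* d ≡ a ℚ.* (b ℚ.- d) ℚ.+ d ℚ.* (a ℚ.- c)
*-difference = solve 4 (λ a b c d → a :* b :- c :* d := a :* (b :- d) :+ d :* (a :- c)) refl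

recip-difference : ∀ a b c d → a ℚ.* (b ℚ.* c) ℚ.- b ℚ.* (a ℚ.* d) ≡ a ℚ.* b ℚ.* (c ℚ.- d)
recip-difference = solve 4 (λ a b c d → a :* (b :* c) :- b :* (a :* d) := a :* b :* (c :- d)) refl

scale : ∀ B ε → 0ℚ ℚ.< B → 0ℚ ℚ.< ε → ∃[ η ] 0ℚ ℚ.< η × B ℚ.* η ≡ ε
scale B ε 0<B 0<ε = ε ℚ.* 1/B , 0<η , eq
  where
  instance
    B-pos = ℚ.positive 0<B
    ε-pos = ℚ.positive 0<ε
    B-nz  = ℚ.pos⇒nonZero B
  1/B = ℚ.1/ B
  0<η : 0ℚ ℚ.< ε ℚ.* 1/B
  0<η = ℚ.positive⁻¹ _ {{ℚ.pos*pos⇒pos ε 1/B {{ℚ.1/pos⇒pos B}}}}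
  eq : B ℚ.* (ε ℚ.* 1/B) ≡ ε
  eq = trans (x[yz]≡y[xz] B ε 1/B)
      (trans (cong (ε ℚ.*_) (ℚ.*-inverseʳ B)) (ℚ.*-identityʳ ε))

*-mono : ∀ {p q r s} → 0ℚ ℚ.≤ r → 0ℚ ℚ.≤ q → p ℚ.≤ q → r ℚ.≤ s → p ℚ.* r ℚ.≤ q ℚ.* s
*-mono {q = q} {r} 0≤r 0≤q p≤q r≤s = ℚ.≤-trans
  (ℚ.*-monoʳ-≤-nonNeg r {{ℚ.nonNegative 0≤r}} p≤q)
  (ℚ.*-monoˡ-≤-nonNeg q {{ℚ.nonNegative 0≤q}} r≤s)

∣∣-lub : ∀ p {ε} → p ℚ.≤ ε → ℚ.- p ℚ.≤ ε → ℚ.∣ p ∣ ℚ.≤ ε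
∣∣-lub p p≤ε -p≤ε = [ (λ e → ℚ.≤-trans (ℚ.≤-reflexive e) p≤ε)
                    , (λ e → ℚ.≤-trans (ℚ.≤-reflexive e) -p≤ε) ]′ (ℚ.∣p∣≡p∨∣p∣≡-p p)

bounded : ∀ {x} → IsCauchy x →
          ∃[ K ] 0ℚ ℚ.< K × ∃[ N ] (∀ n → N ℕ.≤ n → ℚ.∣ x n ∣ ℚ.≤ K)
bounded {x} cx with cx 1ℚ (ℚ.positive⁻¹ 1ℚ)
... | N , close = K , 0<K , N , bound
  where
  K = 1ℚ ℚ.+ ℚ.∣ x N ∣
  0<K : 0ℚ ℚ.< K
  0<K = ℚ.positive⁻¹ K {{ℚ.pos+nonNeg⇒pos 1ℚ ℚ.∣ x N ∣ {{ℚ.∣-∣-nonNeg (x N)}}}}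
  bound : ∀ n → N ℕ.≤ n → ℚ.∣ x n ∣ ℚ.≤ K
  bound n N≤n = begin
    ℚ.∣ x n ∣                          ≡⟨ cong ℚ.∣_∣ (p≡p-q+q (x n) (x N)) ⟩
    ℚ.∣ (x n ℚ.- x N) ℚ.+ x N ∣        ≤⟨ ℚ.∣p+q∣≤∣p∣+∣q∣ (x n ℚ.- x N) (x N) ⟩
    ℚ.∣ x n ℚ.- x N ∣ ℚ.+ ℚ.∣ x N ∣    ≤⟨ ℚ.+-monoˡ-≤ ℚ.∣ x N ∣ (close n N N≤n ℕ.≤-refl) ⟩
    K ∎
    where
    open ℚ.≤-Reasoning

*-close : ∀ a b c d {K J η} → 0ℚ ℚ.≤ K → 0ℚ ℚ.≤ J →
          ℚ.∣ a ∣ ℚ.≤ K → ℚ.∣ d ∣ ℚ.≤ J →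
          ℚ.∣ a ℚ.- c ∣ ℚ.≤ η → ℚ.∣ b ℚ.- d ∣ ℚ.≤ η →
          ℚ.∣ a ℚ.* b ℚ.- c ℚ.* d ∣ ℚ.≤ (K ℚ.+ J) ℚ.* η
*-close a b c d {K} {J} {η} 0≤K 0≤J a≤K d≤J ac≤η bd≤η = begin
  ℚ.∣ a ℚ.* b ℚ.- c ℚ.* d ∣
    ≡⟨ cong ℚ.∣_∣ (*-difference a b c d) ⟩
  ℚ.∣ a ℚ.* (b ℚ.- d) ℚ.+ d ℚ.* (a ℚ.- c) ∣
    ≤⟨ ℚ.∣p+q∣≤∣p∣+∣q∣ (a ℚ.* (b ℚ.- d)) (d ℚ.* (a ℚ.- c)) ⟩
  ℚ.∣ a ℚ.* (b ℚ.- d) ∣ ℚ.+ ℚ.∣ d ℚ.* (a ℚ.- c) ∣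
    ≡⟨ cong₂ ℚ._+_ (ℚ.∣p*q∣≡∣p∣*∣q∣ a (b ℚ.- d)) (ℚ.∣p*q∣≡∣p∣*∣q∣ d (a ℚ.- c)) ⟩
  ℚ.∣ a ∣ ℚ.* ℚ.∣ b ℚ.- d ∣ ℚ.+ ℚ.∣ d ∣ ℚ.* ℚ.∣ a ℚ.- c ∣
    ≤⟨ ℚ.+-mono-≤ (*-mono (ℚ.0≤∣p∣ (b ℚ.- d)) 0≤K a≤K bd≤η)
                  (*-mono (ℚ.0≤∣p∣ (a ℚ.- c)) 0≤J d≤J ac≤η) ⟩
  K ℚ.* η ℚ.+ J ℚ.* η
    ≡⟨ ℚ.*-distribʳ-+ η K J ⟨
  (K ℚ.+ J) ℚ.* η ∎
  where open ℚ.≤-Reasoning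

*-cauchy : ∀ {x y} → IsCauchy x → IsCauchy y → IsCauchy (λ n → x n ℚ.* y n)
*-cauchy {x} {y} cx cy ε 0<ε = N , close
  where
  x-bound = bounded cx
  y-bound = bounded cy
  K = proj₁ x-bound
  J = proj₁ y-bound
  0<K = proj₁ (proj₂ x-bound)
  0<J = proj₁ (proj₂ y-bound)
  step = scale (K ℚ.+ J) ε (ℚ.+-mono-< 0<K 0<J) 0<ε
  x-tail = cx (proj₁ step) (proj₁ (proj₂ step))
  y-tail = cy (proj₁ step) (proj₁ (proj₂ step))
  N₁ = proj₁ (proj₂ (proj₂ x-bound))
  N₂ = proj₁ (proj₂ (proj₂ y-bound))
  N₃ = proj₁ x-tail
  N₄ = proj₁ y-tail
  N = (N₁ ℕ.⊔ N₂) ℕ.⊔ (N₃ ℕ.⊔ N₄)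
  N₁≤ : ∀ {n} → N ℕ.≤ n → N₁ ℕ.≤ n
  N₁≤ N≤n = ℕ.m⊔n≤o⇒m≤o N₁ N₂ (ℕ.m⊔n≤o⇒m≤o (N₁ ℕ.⊔ N₂) (N₃ ℕ.⊔ N₄) N≤n)
  N₂≤ : ∀ {n} → N ℕ.≤ n → N₂ ℕ.≤ n
  N₂≤ N≤n = ℕ.m⊔n≤o⇒n≤o N₁ N₂ (ℕ.m⊔n≤o⇒m≤o (N₁ ℕ.⊔ N₂) (N₃ ℕ.⊔ N₄) N≤n)
  N₃≤ : ∀ {n} → N ℕ.≤ n → N₃ ℕ.≤ n
  N₃≤ N≤n = ℕ.m⊔n≤o⇒m≤o N₃ N₄ (ℕ.m⊔n≤o⇒n≤o (N₁ ℕ.⊔ N₂) (N₃ ℕ.⊔ N₄) N≤n)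
  N₄≤ : ∀ {n} → N ℕ.≤ n → N₄ ℕ.≤ n
  N₄≤ N≤n = ℕ.m⊔n≤o⇒n≤o N₃ N₄ (ℕ.m⊔n≤o⇒n≤o (N₁ ℕ.⊔ N₂) (N₃ ℕ.⊔ N₄) N≤n)
  close : ∀ m n → N ℕ.≤ m → N ℕ.≤ n → ℚ.∣ x m ℚ.* y m ℚ.- x n ℚ.* y n ∣ ℚ.≤ ε
  close m n N≤m N≤n = ℚ.≤-trans
    (*-close (x m) (y m) (x n) (y n) (ℚ.<⇒≤ 0<K) (ℚ.<⇒≤ 0<J)
      (proj₂ (proj₂ (proj₂ x-bound)) m (N₁≤ N≤m))
      (proj₂ (proj₂ (proj₂ y-bound)) n (N₂≤ N≤n))
      (proj₂ x-tail m n (N₃≤ N≤m) (N₃≤ N≤n))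
      (proj₂ y-tail m n (N₄≤ N≤m) (N₄≤ N≤n)))
    (ℚ.≤-reflexive (proj₂ (proj₂ step)))

bounded-nonZero : ∀ {δ y} → 0ℚ ℚ.< δ → δ ℚ.≤ ℚ.∣ y ∣ → ℚ.NonZero y
bounded-nonZero {δ} {y} 0<δ δ≤∣y∣ = ℚ.≢-nonZero {y} λ { refl →
  ℚ.<-irrefl {0ℚ} refl (ℚ.<-≤-trans {0ℚ} {δ} {0ℚ} 0<δ δ≤∣y∣) }

-- Dropping the first N terms makes every remaining term invertible.
recipSeq : (x : ℝ) → x #0 → ℕ → ℚ
recipSeq x (δ , 0<δ , N , δ≤) n =
  (ℚ.1/ seq x (N ℕ.+ n)) {{bounded-nonZero 0<δ (δ≤ (N ℕ.+ n) (ℕ.m≤m+n N n))}}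

recip-bound : ∀ u y {δ D} → u ℚ.* y ≡ 1ℚ → δ ℚ.≤ ℚ.∣ y ∣ →
              0ℚ ℚ.≤ D → δ ℚ.* D ≡ 1ℚ → ℚ.∣ u ∣ ℚ.≤ D
recip-bound u y {δ} {D} uy≡1 δ≤y 0≤D δD≡1 = begin
  ℚ.∣ u ∣                          ≡⟨ ℚ.*-identityʳ ℚ.∣ u ∣ ⟨
  ℚ.∣ u ∣ ℚ.* 1ℚ                   ≡⟨ cong (ℚ.∣ u ∣ ℚ.*_) δD≡1 ⟨
  ℚ.∣ u ∣ ℚ.* (δ ℚ.* D)            ≤⟨ ℚ.*-monoˡ-≤-nonNeg ℚ.∣ u ∣ {{ℚ.∣-∣-nonNeg u}}
                                        (ℚ.*-monoʳ-≤-nonNeg D {{ℚ.nonNegative 0≤D}} δ≤y) ⟩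
  ℚ.∣ u ∣ ℚ.* (ℚ.∣ y ∣ ℚ.* D)      ≡⟨ ℚ.*-assoc ℚ.∣ u ∣ ℚ.∣ y ∣ D ⟨
  ℚ.∣ u ∣ ℚ.* ℚ.∣ y ∣ ℚ.* D        ≡⟨ cong (ℚ._* D) (ℚ.∣p*q∣≡∣p∣*∣q∣ u y) ⟨
  ℚ.∣ u ℚ.* y ∣ ℚ.* D              ≡⟨ cong (λ z → ℚ.∣ z ∣ ℚ.* D) uy≡1 ⟩
  1ℚ ℚ.* D                         ≡⟨ ℚ.*-identityˡ D ⟩
  D ∎
  where open ℚ.≤-Reasoning

recip-close : ∀ u v y z {D η} → u ℚ.* y ≡ 1ℚ → v ℚ.* z ≡ 1ℚ → 0ℚ ℚ.≤ D →
              ℚ.∣ u ∣ ℚ.≤ D → ℚ.∣ v ∣ ℚ.≤ D → ℚ.∣ z ℚ.- y ∣ ℚ.≤ η →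
              ℚ.∣ u ℚ.- v ∣ ℚ.≤ D ℚ.* D ℚ.* η
recip-close u v y z {D} {η} uy≡1 vz≡1 0≤D u≤D v≤D zy≤η = begin
  ℚ.∣ u ℚ.- v ∣
    ≡⟨ cong₂ (λ a b → ℚ.∣ a ℚ.- b ∣) (ℚ.*-identityʳ u) (ℚ.*-identityʳ v) ⟨
  ℚ.∣ u ℚ.* 1ℚ ℚ.- v ℚ.* 1ℚ ∣
    ≡⟨ cong₂ (λ a b → ℚ.∣ u ℚ.* a ℚ.- v ℚ.* b ∣) vz≡1 uy≡1 ⟨
  ℚ.∣ u ℚ.* (v ℚ.* z) ℚ.- v ℚ.* (u ℚ.* y) ∣
    ≡⟨ cong ℚ.∣_∣ (recip-difference u v z y) ⟩
  ℚ.∣ u ℚ.* v ℚ.* (z ℚ.- y) ∣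
    ≡⟨ ℚ.∣p*q∣≡∣p∣*∣q∣ (u ℚ.* v) (z ℚ.- y) ⟩
  ℚ.∣ u ℚ.* v ∣ ℚ.* ℚ.∣ z ℚ.- y ∣
    ≡⟨ cong (ℚ._* ℚ.∣ z ℚ.- y ∣) (ℚ.∣p*q∣≡∣p∣*∣q∣ u v) ⟩
  ℚ.∣ u ∣ ℚ.* ℚ.∣ v ∣ ℚ.* ℚ.∣ z ℚ.- y ∣
    ≤⟨ *-mono (ℚ.0≤∣p∣ (z ℚ.- y)) (ℚ.nonNegative⁻¹ (D ℚ.* D) {{ℚ.nonNeg*nonNeg⇒nonNeg D {{D≥0}} D {{D≥0}}}})
         (*-mono (ℚ.0≤∣p∣ v) 0≤D u≤D v≤D) zy≤η ⟩
  D ℚ.* D ℚ.* η ∎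
  where
  open ℚ.≤-Reasoning
  D≥0 : ℚ.NonNegative D
  D≥0 = ℚ.nonNegative 0≤D

recip-cauchy : ∀ x (x#0 : x #0) → IsCauchy (recipSeq x x#0)
recip-cauchy x x#0@(δ , 0<δ , N , δ≤) ε 0<ε = proj₁ tail , close
  where
  u : ℕ → ℚ
  u = recipSeq x x#0
  y : ℕ → ℚ
  y n = seq x (N ℕ.+ n)
  step₁ = scale δ 1ℚ 0<δ (ℚ.positive⁻¹ 1ℚ)
  D = proj₁ step₁
  0<D = proj₁ (proj₂ step₁)
  step₂ = scale (D ℚ.* D) ε
    (ℚ.positive⁻¹ (D ℚ.* D) {{ℚ.pos*pos⇒pos D {{ℚ.positive 0<D}} D {{ℚ.positive 0<D}}}}) 0<ε
  η = proj₁ step₂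
  tail = cauchy x η (proj₁ (proj₂ step₂))
  δ≤y : ∀ n → δ ℚ.≤ ℚ.∣ y n ∣
  δ≤y n = δ≤ (N ℕ.+ n) (ℕ.m≤m+n N n)
  uy≡1 : ∀ n → u n ℚ.* y n ≡ 1ℚ
  uy≡1 n = ℚ.*-inverseˡ (y n) {{bounded-nonZero 0<δ (δ≤y n)}}
  u≤D : ∀ n → ℚ.∣ u n ∣ ℚ.≤ D
  u≤D n = recip-bound (u n) (y n) (uy≡1 n) (δ≤y n) (ℚ.<⇒≤ 0<D) (proj₂ (proj₂ step₁))
  close : ∀ m n → proj₁ tail ℕ.≤ m → proj₁ tail ℕ.≤ n → ℚ.∣ u m ℚ.- u n ∣ ℚ.≤ ε
  close m n M≤m M≤n = ℚ.≤-trans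
    (recip-close (u m) (u n) (y m) (y n) (uy≡1 m) (uy≡1 n) (ℚ.<⇒≤ 0<D) (u≤D m) (u≤D n)
      (proj₂ tail (N ℕ.+ n) (N ℕ.+ m) (ℕ.m≤n⇒m≤o+n N M≤n) (ℕ.m≤n⇒m≤o+n N M≤m)))
    (ℚ.≤-reflexive (proj₂ (proj₂ step₂)))

infixl 7 _/_⟨_⟩

_/_⟨_⟩ : (x y : ℝ) → y #0 → ℝ
x / y ⟨ y#0 ⟩ = mkℝ (λ n → seq x n ℚ.* recipSeq y y#0 n)
                    (*-cauchy {seq x} {recipSeq y y#0} (cauchy x) (recip-cauchy y y#0))

------------------------------------------------------------------------
-- Square roots of integers

bump : ℕ → ℕ → ℕ
bump n r with suc r ℕ.* suc r ℕ.≤? n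
... | yes _ = suc r
... | no  _ = r

isqrt : ℕ → ℕ
isqrt zero    = zero
isqrt (suc n) = bump (suc n) (isqrt n)

isqrt-lower : ∀ n → isqrt n ℕ.* isqrt n ℕ.≤ n
isqrt-lower zero    = z≤n
isqrt-lower (suc n) with suc (isqrt n) ℕ.* suc (isqrt n) ℕ.≤? suc n
... | yes p = p
... | no  _ = ℕ.m≤n⇒m≤1+n (isqrt-lower n)

isqrt-upper : ∀ n → n ℕ.< suc (isqrt n) ℕ.* suc (isqrt n)
isqrt-upper zero    = s≤s z≤n
isqrt-upper (suc n) with suc (isqrt n) ℕ.* suc (isqrt n) ℕ.≤? suc n
... | yes _ = ℕ.≤-<-trans (isqrt-upper n)
  (ℕ.*-mono-< {suc (isqrt n)} {suc (suc (isqrt n))} {suc (isqrt n)} ℕ.≤-refl ℕ.≤-refl)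
... | no ¬p = ℕ.≰⇒> ¬p

-- ⌊ s √a ⌋ / s with s = n + 1
√seq : ℕ → ℕ → ℚ
√seq a n = + isqrt (a ℕ.* (suc n ℕ.* suc n)) ℚ./ suc n

/-mono-≤ : ∀ i m j n → i ℤ.* + suc n ℤ.≤ j ℤ.* + suc m → i ℚ./ suc m ℚ.≤ j ℚ./ suc n
/-mono-≤ i m j n le = ℚ.toℚᵘ-cancel-≤
  (ℚᵘ.≤-respˡ-≃ (ℚᵘ.≃-sym (ℚ.toℚᵘ-fromℚᵘ (mkℚᵘ i m)))
  (ℚᵘ.≤-respʳ-≃ (ℚᵘ.≃-sym (ℚ.toℚᵘ-fromℚᵘ (mkℚᵘ j n))) (ℚᵘ.*≤* le)))

suc-/ : ∀ r n → + suc r ℚ./ suc n ≡ + r ℚ./ suc n ℚ.+ + 1 ℚ./ suc n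
suc-/ r n = ℚ.toℚᵘ-injective (begin
  ℚ.toℚᵘ (+ suc r ℚ./ suc n)                            ≈⟨ ℚ.toℚᵘ-fromℚᵘ (mkℚᵘ (+ suc r) n) ⟩
  mkℚᵘ (+ suc r) n                                      ≈⟨ ℚᵘ.*≡* (arith (+ r) (+ suc n)) ⟩
  mkℚᵘ (+ r) n ℚᵘ.+ mkℚᵘ (+ 1) n                        ≈⟨ ℚᵘ.+-cong (ℚ.toℚᵘ-fromℚᵘ (mkℚᵘ (+ r) n)) (ℚ.toℚᵘ-fromℚᵘ (mkℚᵘ (+ 1) n)) ⟨
  ℚ.toℚᵘ (+ r ℚ./ suc n) ℚᵘ.+ ℚ.toℚᵘ (+ 1 ℚ./ suc n)    ≈⟨ ℚ.toℚᵘ-homo-+ (+ r ℚ./ suc n) (+ 1 ℚ./ suc n) ⟨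
  ℚ.toℚᵘ (+ r ℚ./ suc n ℚ.+ + 1 ℚ./ suc n)              ∎)
  where
  open ℚᵘ.≃-Reasoning
  arith : ∀ r N → (1ℤ ℤ.+ r) ℤ.* (N ℤ.* N) ≡ (r ℤ.* N ℤ.+ 1ℤ ℤ.* N) ℤ.* N
  arith = ℤSolver.solve-∀

√-step : ∀ a m n → √seq a m ℚ.- √seq a n ℚ.≤ + 1 ℚ./ suc n
√-step a m n = begin
  √seq a m ℚ.- √seq a n                                 ≤⟨ ℚ.+-monoˡ-≤ (ℚ.- √seq a n) le ⟩
  (√seq a n ℚ.+ + 1 ℚ./ suc n) ℚ.- √seq a n             ≡⟨ p+q-p≡q (√seq a n) (+ 1 ℚ./ suc n) ⟩
  + 1 ℚ./ suc n                                         ∎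
  where
  open ℚ.≤-Reasoning
  M = suc m
  N = suc n
  r = isqrt (a ℕ.* (M ℕ.* M))
  t = suc (isqrt (a ℕ.* (N ℕ.* N)))
  sq-le : (r ℕ.* N) ℕ.* (r ℕ.* N) ℕ.< (t ℕ.* M) ℕ.* (t ℕ.* M)
  sq-le = ℕR.begin-strict
    (r ℕ.* N) ℕ.* (r ℕ.* N)             ℕR.≡⟨ shuffle₁ r N ⟩
    (r ℕ.* r) ℕ.* (N ℕ.* N)             ℕR.≤⟨ ℕ.*-monoˡ-≤ (N ℕ.* N) (isqrt-lower (a ℕ.* (M ℕ.* M))) ⟩
    (a ℕ.* (M ℕ.* M)) ℕ.* (N ℕ.* N)     ℕR.≡⟨ shuffle₂ a M N ⟩
    (a ℕ.* (N ℕ.* N)) ℕ.* (M ℕ.* M)     ℕR.<⟨ ℕ.*-monoˡ-< (M ℕ.* M) (isqrt-upper (a ℕ.* (N ℕ.* N))) ⟩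
    (t ℕ.* t) ℕ.* (M ℕ.* M)             ℕR.≡⟨ shuffle₁ t M ⟨
    (t ℕ.* M) ℕ.* (t ℕ.* M)             ℕR.∎
    where
    module ℕR = ℕ.≤-Reasoning
    shuffle₁ : ∀ x y → (x ℕ.* y) ℕ.* (x ℕ.* y) ≡ (x ℕ.* x) ℕ.* (y ℕ.* y)
    shuffle₁ = solve-∀
    shuffle₂ : ∀ x y z → (x ℕ.* (y ℕ.* y)) ℕ.* (z ℕ.* z) ≡ (x ℕ.* (z ℕ.* z)) ℕ.* (y ℕ.* y)
    shuffle₂ = solve-∀
  rN≤tM : r ℕ.* N ℕ.≤ t ℕ.* M
  rN≤tM with r ℕ.* N ℕ.≤? t ℕ.* M
  ... | yes p = p
  ... | no ¬p = contradiction (ℕ.*-mono-≤ (ℕ.≰⇒≥ ¬p) (ℕ.≰⇒≥ ¬p)) (ℕ.<⇒≱ sq-le)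
  le : √seq a m ℚ.≤ √seq a n ℚ.+ + 1 ℚ./ suc n
  le = ℚ.≤-trans
    (/-mono-≤ (+ r) m (+ t) n
      (subst (ℤ._≤ + t ℤ.* + M) (ℤ.pos-* r N)
        (subst (+ (r ℕ.* N) ℤ.≤_) (ℤ.pos-* t M) (ℤ.+≤+ rN≤tM))))
    (ℚ.≤-reflexive (suc-/ (isqrt (a ℕ.* (N ℕ.* N))) n))

archimedes : ∀ ε → 0ℚ ℚ.< ε → ∀ n → ℚ.↧ₙ ε ℕ.≤ n → + 1 ℚ./ suc n ℚ.≤ ε
archimedes ε@(ℚ.mkℚ (+ zero) d _) 0<ε n d<n with ℚ.drop-*<* 0<ε
... | ℤ.+<+ ()
archimedes ε@(ℚ.mkℚ -[1+ p ] d _) 0<ε n d<n with ℚ.drop-*<* 0<ε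
... | ()
archimedes ε@(ℚ.mkℚ (+ suc p) d _) 0<ε n d<n = ℚ.≤-trans
  (/-mono-≤ (+ 1) n (+ suc p) d (ℤ.+≤+ (ℕ.*-mono-≤ {1} {suc p} (s≤s z≤n) (ℕ.m≤n⇒m≤1+n d<n))))
  (ℚ.≤-reflexive (ℚ.↥p/↧p≡p ε))

√-cauchy : ∀ a → IsCauchy (√seq a)
√-cauchy a ε 0<ε = ℚ.↧ₙ ε , λ m n N≤m N≤n → ∣∣-lub (√seq a m ℚ.- √seq a n)
  (ℚ.≤-trans (√-step a m n) (archimedes ε 0<ε n N≤n))
  (ℚ.≤-trans (ℚ.≤-reflexive (neg-flip (√seq a m) (√seq a n))) (ℚ.≤-trans (√-step a n m) (archimedes ε 0<ε m N≤m)))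

-- Only applied to Gram determinants det(V Vᵀ), which are nonnegative; the
-- value 0 on negative integers is a convention.
infix 8 √_

√_ : ℤ → ℝ
√ (+ a)    = mkℝ (√seq a) (√-cauchy a)
√ -[1+ _ ] = mkℝ (√seq 0) (√-cauchy 0)

------------------------------------------------------------------------
-- Integer matrices

sum : ∀ {n} → Vector ℤ n → ℤ
sum = sumOf ℤ.+-*-semiring

Matrix : ℕ → ℕ → Set
Matrix m n = Fin m → Fin n → ℤ

infix  9 _ᵀ
infixl 7 _·_

_ᵀ : ∀ {m n} → Matrix m n → Matrix n m
(M ᵀ) j i = M i j

_·_ : ∀ {l m n} → Matrix l m → Matrix m n → Matrix l n
(M · N) i k = sum λ j → M i j ℤ.* N j k

IsZero : ∀ {m n} → Matrix m n → Set
IsZero M = ∀ i j → M i j ≡ 0ℤ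

sign : ∀ {n} → Fin n → ℤ
sign zero    = 1ℤ
sign (suc j) = ℤ.- sign j

-- Laplace expansion along the first row.
det : ∀ {n} → Matrix n n → ℤ
det {zero}  M = 1ℤ
det {suc n} M = sum λ j → sign j ℤ.* M zero j ℤ.* det (λ i l → M (suc i) (punchIn j l))

rowCombination : ∀ {m n} → Vector ℤ m → Matrix m n → Vector ℤ n
rowCombination c M j = sum λ i → c i ℤ.* M i j

-- Full row rank: the rows are linearly independent.  Integer coefficients
-- give the same notion as rational or real ones, by clearing denominators.
FullRowRank : ∀ {m n} → Matrix m n → Set
FullRowRank M = ∀ c → (∀ j → rowCombination c M j ≡ 0ℤ) → ∀ i → c i ≡ 0ℤ

------------------------------------------------------------------------
-- Lattices, given by their membership predicate

Lattice : ℕ → Set₁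
Lattice n = Pred (Vector ℤ n) 0ℓ

rowLattice : ∀ {m n} → Matrix m n → Lattice n
rowLattice M v = ∃[ c ] (∀ j → v j ≡ rowCombination c M j)

colLattice : ∀ {m n} → Matrix m n → Lattice m
colLattice M = rowLattice (M ᵀ)

-- The rows of V form a ℤ-basis of L.
IsBasis : ∀ {r n} → Matrix r n → Lattice n → Set
IsBasis V L = (∀ v → v ∈ L ⇔ v ∈ rowLattice V) × FullRowRank V

-- d = det L.  A relation rather than a function, since the value is
-- computed from a chosen basis.
IsDet : ∀ {n} → Lattice n → ℝ → Set
IsDet {n} L d = ∃[ r ] Σ[ V ∈ Matrix r n ] IsBasis V L × d ≈ √ det (V · V ᵀ)

-- ν = ndet Λ, computed from some basis matrix M of Λ.
IsNdet : ∀ {n} → Lattice n → ℝ → Set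
IsNdet {n} Λ ν = ∃[ r ] Σ[ M ∈ Matrix r n ] IsBasis M Λ ×
  (Σ[ d ∈ ℝ ] Σ[ c ∈ ℝ ] IsDet (rowLattice M) d × IsDet (colLattice M) c ×
    Σ[ c#0 ∈ c #0 ] ν ≈ d / c ⟨ c#0 ⟩)

{-# OPTIONS --safe #-}

-- Write A = Wᵀ P, where the rows of W are a basis of L_C(A); then P has a
-- right inverse over ℤ and det (A Aᵀ) = det W² · det (P Pᵀ), while
-- det (L_C(A)) = |det W|.  So the quotient for A is √ det (P Pᵀ), and likewise
-- √ det (P′ P′ᵀ) for B = W′ᵀ P′.  Cancelling W and W′ gives P P′ᵀ = 0, and
-- with right inverses P Qᵀ = 1, P′ Q′ᵀ = 1 the square matrices N = (P / Q′),
-- S = (P / P′) and T = (Q / P′) have block lower triangular products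
-- N Sᵀ, S Tᵀ, N Tᵀ.  Hence det N det S = det (P Pᵀ), det S det T = det (P′ P′ᵀ)
-- and det N det T = 1, which forces det N = det T.

module Submission where

open import Defs
open import Data.Nat.Base using (ℕ; _<_; _∸_)
open import Data.Product.Base using (Σ-syntax; _×_)

open import Data.Fin.Base using (Fin; zero; suc; punchIn; punchOut; _↑ˡ_; _↑ʳ_)
import Data.Fin.Properties as Fin
open import Data.Integer.Base as ℤ using (ℤ; 0ℤ; 1ℤ; -1ℤ; _+_; _*_; -_; _-_; ∣_∣; -[1+_])
import Data.Integer.Properties as ℤ
open import Data.Integer.Tactic.RingSolver using (solve-∀)
open import Data.Nat.Base as ℕ using (zero; suc; s≤s)
import Data.Nat.Properties as ℕ
import Data.Nat.Tactic.RingSolver as ℕSolver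
open import Data.Product.Base using (∃-syntax; _,_; proj₁; proj₂)
open import Data.Rational.Base as ℚ using (ℚ; 0ℚ; 1ℚ)
import Data.Rational.Properties as ℚ
open import Data.Rational.Solver using (module +-*-Solver)
open import Data.Rational.Unnormalised.Base as ℚᵘ using (mkℚᵘ)
import Data.Rational.Unnormalised.Properties as ℚᵘ
open import Data.Sum.Base using ([_,_]′)
open import Data.Vec.Functional using (Vector; _∷_; _++_; tail; insertAt)
open import Data.Vec.Functional.Properties
  using (lookup-++ˡ; lookup-++ʳ; insertAt-lookup; insertAt-punchIn; insertAt-removeAt)
open import Function.Base using (_∘_)
open import Function.Bundles using (Equivalence)
open import Relation.Binary.PropositionalEquality
  using (_≡_; _≢_; _≗_; refl; sym; trans; cong; cong₂; subst; module ≡-Reasoning)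
open import Relation.Nullary using (yes; no; contradiction; ¬?)
open import Relation.Nullary.Decidable using (decidable-stable)
open import Relation.Unary using (_∈_; _⊆_)

open import Algebra.Properties.Semiring.Sum ℤ.+-*-semiring
  using (sum-cong-≗; ∑-distrib-+; ∑-comm; *-distribˡ-sum; *-distribʳ-sum; sum-replicate-zero; sum-remove)

open +-*-Solver using (solve; _:=_; _:+_; _:*_; _:-_)

-- Sequences of rationals

-- The rows of P span the saturation of L_R(A), so the claim says that two saturated lattices which
-- are orthogonal complements have equal determinants. A common route completes P to a unimodular
-- matrix, which calls for a normal form. Here right inverses suffice, and a lattice basis yields
-- them at once: writing the generators in the basis and the basis in the generators gives two
-- matrices with Y X = 1. The stack N takes the place of the completion, and its unimodularity falls
-- out of det N det T = 1 instead of being built in. Two more demands come from the definitions.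
-- Lattice determinants are relations over arbitrary bases, so independence of the basis has to be
-- proved. And the quotients are Cauchy sequences; but det (L_C(A)) is a positive integer |det W|,
-- so the analysis reduces to how integer square roots scale by a natural number. Since det is a
-- Laplace expansion, its product and transposition rules are drawn from the uniqueness of
-- alternating forms.

Eventually : (ℕ → Set) → Set
Eventually P = ∃[ N ] (∀ n → N ℕ.≤ n → P n)

eventually-× : ∀ {P Q : ℕ → Set} → Eventually P → Eventually Q → Eventually (λ n → P n × Q n)
eventually-× (M , p) (N , q) = M ℕ.⊔ N , λ n le →
  p n (ℕ.m⊔n≤o⇒m≤o M N le) , q n (ℕ.m⊔n≤o⇒n≤o M N le)

infix 4 _~_

-- The condition of `_≈_` on bare sequences, so that intermediate approximants such as r times
-- `seq y n` need no proof of being Cauchy.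
_~_ : (x y : ℕ → ℚ) → Set
x ~ y = ∀ ε → 0ℚ ℚ.< ε → Eventually (λ n → ℚ.∣ x n ℚ.- y n ∣ ℚ.≤ ε)

∣p-q∣≡∣q-p∣ : ∀ p q → ℚ.∣ p ℚ.- q ∣ ≡ ℚ.∣ q ℚ.- p ∣
∣p-q∣≡∣q-p∣ p q = trans (sym (ℚ.∣-p∣≡∣p∣ (p ℚ.- q))) (cong ℚ.∣_∣ (neg-flip p q))

~-sym : ∀ x y → x ~ y → y ~ x
~-sym x y x~y ε 0<ε with x~y ε 0<ε
... | N , close = N , λ n N≤n → subst (ℚ._≤ ε) (∣p-q∣≡∣q-p∣ (x n) (y n)) (close n N≤n)

~-trans : ∀ x y z → x ~ y → y ~ z → x ~ z
~-trans x y z x~y y~z ε 0<ε = proj₁ tails , λ n N≤n → begin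
  ℚ.∣ x n ℚ.- z n ∣                           ≡⟨ cong ℚ.∣_∣ (telescope (x n) (y n) (z n)) ⟩
  ℚ.∣ (x n ℚ.- y n) ℚ.+ (y n ℚ.- z n) ∣       ≤⟨ ℚ.∣p+q∣≤∣p∣+∣q∣ (x n ℚ.- y n) (y n ℚ.- z n) ⟩
  ℚ.∣ x n ℚ.- y n ∣ ℚ.+ ℚ.∣ y n ℚ.- z n ∣     ≤⟨ ℚ.+-mono-≤ (proj₁ (proj₂ tails n N≤n)) (proj₂ (proj₂ tails n N≤n)) ⟩
  η ℚ.+ η                                     ≡⟨ cong₂ ℚ._+_ (ℚ.*-identityˡ η) (ℚ.*-identityˡ η) ⟨
  1ℚ ℚ.* η ℚ.+ 1ℚ ℚ.* η                       ≡⟨ ℚ.*-distribʳ-+ η 1ℚ 1ℚ ⟨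
  (1ℚ ℚ.+ 1ℚ) ℚ.* η                           ≡⟨ proj₂ (proj₂ half) ⟩
  ε                                           ∎
  where
  open ℚ.≤-Reasoning
  half = scale (1ℚ ℚ.+ 1ℚ) ε (ℚ.positive⁻¹ (1ℚ ℚ.+ 1ℚ)) 0<ε
  η = proj₁ half
  tails = eventually-× (x~y η (proj₁ (proj₂ half))) (y~z η (proj₁ (proj₂ half)))
  telescope : ∀ x y z → x ℚ.- z ≡ (x ℚ.- y) ℚ.+ (y ℚ.- z)
  telescope = solve 3 (λ x y z → x :- z := (x :- y) :+ (y :- z)) refl

≗⇒~ : ∀ {x y} → x ≗ y → x ~ y
≗⇒~ {x} {y} x≗y ε 0<ε = 0 , λ n _ → subst (λ z → ℚ.∣ z ∣ ℚ.≤ ε)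
  (sym (trans (cong (ℚ._- y n) (x≗y n)) (ℚ.+-inverseʳ (y n)))) (ℚ.<⇒≤ 0<ε)

-- Terms within r/2 of a positive limit r keep absolute value at least r/2, which serves as the
-- bound `δ`.
~-const⇒#0 : ∀ c {r} → 0ℚ ℚ.< r → seq c ~ (λ _ → r) → c #0
~-const⇒#0 c {r} 0<r c~r = δ , 0<δ , proj₁ near , λ n N≤n → begin
  δ                                                   ≡⟨ split r (proj₂ (proj₂ half)) ⟩
  r ℚ.- δ                                             ≤⟨ ℚ.+-monoˡ-≤ (ℚ.- δ) (bound n N≤n) ⟩
  (δ ℚ.+ ℚ.∣ seq c n ∣) ℚ.- δ                         ≡⟨ p+q-p≡q δ ℚ.∣ seq c n ∣ ⟩
  ℚ.∣ seq c n ∣                                       ∎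
  where
  open ℚ.≤-Reasoning
  half = scale (1ℚ ℚ.+ 1ℚ) r (ℚ.positive⁻¹ (1ℚ ℚ.+ 1ℚ)) 0<r
  δ = proj₁ half
  0<δ = proj₁ (proj₂ half)
  near = c~r δ 0<δ
  double-minus : ∀ d → d ≡ (d ℚ.+ d) ℚ.- d
  double-minus = solve 1 (λ d → d := (d :+ d) :- d) refl
  split : ∀ r → (1ℚ ℚ.+ 1ℚ) ℚ.* δ ≡ r → δ ≡ r ℚ.- δ
  split r eq = trans (double-minus δ) (cong (ℚ._- δ)
    (trans (sym (cong₂ ℚ._+_ (ℚ.*-identityˡ δ) (ℚ.*-identityˡ δ))) (trans (sym (ℚ.*-distribʳ-+ δ 1ℚ 1ℚ)) eq)))
  bound : ∀ n → proj₁ near ℕ.≤ n → r ℚ.≤ δ ℚ.+ ℚ.∣ seq c n ∣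
  bound n N≤n = begin
    r                                        ≡⟨ ℚ.0≤p⇒∣p∣≡p (ℚ.<⇒≤ 0<r) ⟨
    ℚ.∣ r ∣                                  ≡⟨ cong ℚ.∣_∣ (p≡p-q+q r (seq c n)) ⟩
    ℚ.∣ (r ℚ.- seq c n) ℚ.+ seq c n ∣        ≤⟨ ℚ.∣p+q∣≤∣p∣+∣q∣ (r ℚ.- seq c n) (seq c n) ⟩
    ℚ.∣ r ℚ.- seq c n ∣ ℚ.+ ℚ.∣ seq c n ∣    ≡⟨ cong (ℚ._+ ℚ.∣ seq c n ∣) (∣p-q∣≡∣q-p∣ r (seq c n)) ⟩
    ℚ.∣ seq c n ℚ.- r ∣ ℚ.+ ℚ.∣ seq c n ∣    ≤⟨ ℚ.+-monoˡ-≤ ℚ.∣ seq c n ∣ (proj₂ near n N≤n) ⟩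
    δ ℚ.+ ℚ.∣ seq c n ∣                      ∎

-- x / c - y = (x - r y) / c + y (r - c) / c
quotient-limit : ∀ x c y {r} → seq c ~ (λ _ → r) → seq x ~ (λ n → r ℚ.* seq y n) →
                 ∀ (c#0 : c #0) → x / c ⟨ c#0 ⟩ ≈ y
quotient-limit x c y {r} c~r x~ry c#0@(δ , 0<δ , N , δ≤) ε 0<ε = proj₁ tails , λ n le →
  let |y|≤K , |x-ry|≤η , |c-r|≤η = proj₂ tails n le in begin
  ℚ.∣ seq x n ℚ.* u n ℚ.- seq y n ∣
    ≡⟨ cong (λ z → ℚ.∣ seq x n ℚ.* u n ℚ.- z ∣) (trans (cong (seq y n ℚ.*_) (uc≡1 n)) (ℚ.*-identityʳ (seq y n))) ⟨
  ℚ.∣ seq x n ℚ.* u n ℚ.- seq y n ℚ.* (u n ℚ.* c′ n) ∣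
    ≡⟨ cong ℚ.∣_∣ (decompose (seq x n) (u n) (seq y n) (c′ n) r) ⟩
  ℚ.∣ u n ℚ.* (seq x n ℚ.- r ℚ.* seq y n) ℚ.+ u n ℚ.* (seq y n ℚ.* (r ℚ.- c′ n)) ∣
    ≤⟨ ℚ.∣p+q∣≤∣p∣+∣q∣ (u n ℚ.* (seq x n ℚ.- r ℚ.* seq y n)) (u n ℚ.* (seq y n ℚ.* (r ℚ.- c′ n))) ⟩
  ℚ.∣ u n ℚ.* (seq x n ℚ.- r ℚ.* seq y n) ∣ ℚ.+ ℚ.∣ u n ℚ.* (seq y n ℚ.* (r ℚ.- c′ n)) ∣
    ≤⟨ ℚ.+-mono-≤ (∣*∣-mono (u n) (seq x n ℚ.- r ℚ.* seq y n) 0≤D (u≤D n) |x-ry|≤η)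
         (∣*∣-mono (u n) (seq y n ℚ.* (r ℚ.- c′ n)) 0≤D (u≤D n)
           (∣*∣-mono (seq y n) (r ℚ.- c′ n) (ℚ.<⇒≤ 0<K) |y|≤K
             (subst (ℚ._≤ η) (∣p-q∣≡∣q-p∣ (c′ n) r) (|c-r|≤η)))) ⟩
  D ℚ.* η ℚ.+ D ℚ.* (K ℚ.* η)
    ≡⟨ collect D K η ⟩
  (D ℚ.+ D ℚ.* K) ℚ.* η
    ≡⟨ proj₂ (proj₂ step) ⟩
  ε ∎
  where
  open ℚ.≤-Reasoning
  u c′ : ℕ → ℚ
  u = recipSeq c c#0
  c′ n = seq c (N ℕ.+ n)
  recipBound = scale δ 1ℚ 0<δ (ℚ.positive⁻¹ 1ℚ)
  D = proj₁ recipBound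
  0<D = proj₁ (proj₂ recipBound)
  0≤D = ℚ.<⇒≤ 0<D
  y-bound = bounded {seq y} (cauchy y)
  K = proj₁ y-bound
  0<K = proj₁ (proj₂ y-bound)
  0<DK : 0ℚ ℚ.< D ℚ.* K
  0<DK = ℚ.positive⁻¹ (D ℚ.* K) {{ℚ.pos*pos⇒pos D {{ℚ.positive 0<D}} K {{ℚ.positive 0<K}}}}
  -- The two error terms are at most D η and D K η, since D bounds 1/c and K bounds y.
  step = scale (D ℚ.+ D ℚ.* K) ε (ℚ.+-mono-< 0<D 0<DK) 0<ε
  η = proj₁ step
  0<η = proj₁ (proj₂ step)
  -- Division drops the first N terms of c but none of x and y. This shift does no harm because c is
  -- compared with a constant.
  c′-tail : Eventually (λ n → ℚ.∣ c′ n ℚ.- r ∣ ℚ.≤ η)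
  c′-tail = let M , close = c~r η 0<η in M , λ n M≤n → close (N ℕ.+ n) (ℕ.m≤n⇒m≤o+n N M≤n)
  tails = eventually-× (proj₂ (proj₂ y-bound)) (eventually-× (x~ry η 0<η) c′-tail)
  δ≤c′ : ∀ n → δ ℚ.≤ ℚ.∣ c′ n ∣
  δ≤c′ n = δ≤ (N ℕ.+ n) (ℕ.m≤m+n N n)
  uc≡1 : ∀ n → u n ℚ.* c′ n ≡ 1ℚ
  uc≡1 n = ℚ.*-inverseˡ (c′ n) {{bounded-nonZero 0<δ (δ≤c′ n)}}
  u≤D : ∀ n → ℚ.∣ u n ∣ ℚ.≤ D
  u≤D n = recip-bound (u n) (c′ n) (uc≡1 n) (δ≤c′ n) 0≤D (proj₂ (proj₂ recipBound))
  ∣*∣-mono : ∀ p q {s t} → 0ℚ ℚ.≤ s → ℚ.∣ p ∣ ℚ.≤ s → ℚ.∣ q ∣ ℚ.≤ t → ℚ.∣ p ℚ.* q ∣ ℚ.≤ s ℚ.* t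
  ∣*∣-mono p q 0≤s p≤s q≤t =
    ℚ.≤-trans (ℚ.≤-reflexive (ℚ.∣p*q∣≡∣p∣*∣q∣ p q)) (*-mono (ℚ.0≤∣p∣ q) 0≤s p≤s q≤t)
  decompose : ∀ x u y c r → x ℚ.* u ℚ.- y ℚ.* (u ℚ.* c) ≡ u ℚ.* (x ℚ.- r ℚ.* y) ℚ.+ u ℚ.* (y ℚ.* (r ℚ.- c))
  decompose = solve 5 (λ x u y c r → x :* u :- y :* (u :* c) := u :* (x :- r :* y) :+ u :* (y :* (r :- c))) refl
  collect : ∀ D K η → D ℚ.* η ℚ.+ D ℚ.* (K ℚ.* η) ≡ (D ℚ.+ D ℚ.* K) ℚ.* η
  collect = solve 3 (λ D K η → D :* η :+ D :* (K :* η) := (D :+ D :* K) :* η) refl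

-- Square roots

fromℕ : ℕ → ℚ
fromℕ p = ℤ.+ p ℚ./ 1

0<fromℕ : ∀ p → 0ℚ ℚ.< fromℕ (suc p)
0<fromℕ p = ℚ.positive⁻¹ _ {{ℚ.normalize-pos (suc p) 1}}

fromℕ-*-/ : ∀ p s n → fromℕ p ℚ.* (ℤ.+ s ℚ./ suc n) ≡ ℤ.+ (p ℕ.* s) ℚ./ suc n
fromℕ-*-/ p s n = ℚ.toℚᵘ-injective (begin
  ℚ.toℚᵘ (fromℕ p ℚ.* (ℤ.+ s ℚ./ suc n))               ≈⟨ ℚ.toℚᵘ-homo-* (fromℕ p) (ℤ.+ s ℚ./ suc n) ⟩
  ℚ.toℚᵘ (fromℕ p) ℚᵘ.* ℚ.toℚᵘ (ℤ.+ s ℚ./ suc n)       ≈⟨ ℚᵘ.*-cong (ℚ.toℚᵘ-fromℚᵘ (mkℚᵘ (ℤ.+ p) 0)) (ℚ.toℚᵘ-fromℚᵘ (mkℚᵘ (ℤ.+ s) n)) ⟩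
  mkℚᵘ (ℤ.+ p) 0 ℚᵘ.* mkℚᵘ (ℤ.+ s) n                   ≈⟨ ℚᵘ.*≡* (cong₂ ℤ._*_ (sym (ℤ.pos-* p s)) (cong ℤ.+_ (sym (ℕ.+-identityʳ (suc n))))) ⟩
  mkℚᵘ (ℤ.+ (p ℕ.* s)) n                               ≈⟨ ℚ.toℚᵘ-fromℚᵘ (mkℚᵘ (ℤ.+ (p ℕ.* s)) n) ⟨
  ℚ.toℚᵘ (ℤ.+ (p ℕ.* s) ℚ./ suc n)                     ∎)
  where open ℚᵘ.≃-Reasoning

/-monoˡ-≤ : ∀ {s t} n → s ℕ.≤ t → ℤ.+ s ℚ./ suc n ℚ.≤ ℤ.+ t ℚ./ suc n
/-monoˡ-≤ {s} {t} n s≤t = /-mono-≤ (ℤ.+ s) n (ℤ.+ t) n (ℤ.*-monoʳ-≤-nonNeg (ℤ.+ suc n) (ℤ.+≤+ s≤t))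

square-cancel-< : ∀ {x y} → x ℕ.* x ℕ.< y ℕ.* y → x ℕ.< y
square-cancel-< xx<yy = ℕ.≰⇒> λ y≤x → ℕ.<⇒≱ xx<yy (ℕ.*-mono-≤ y≤x y≤x)

square-* : ∀ x y → (x ℕ.* y) ℕ.* (x ℕ.* y) ≡ (x ℕ.* x) ℕ.* (y ℕ.* y)
square-* = ℕSolver.solve-∀

-- Squares are compared with that of the successor of the root, the form in which `isqrt-upper`
-- bounds from above; the strict inequality then loses its `suc`.
isqrt-scale-lower : ∀ p a → p ℕ.* isqrt a ℕ.≤ isqrt (p ℕ.* p ℕ.* a)
isqrt-scale-lower p a = ℕ.s≤s⁻¹ (square-cancel-< (begin-strict
  (p ℕ.* isqrt a) ℕ.* (p ℕ.* isqrt a)    ≡⟨ square-* p (isqrt a) ⟩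
  (p ℕ.* p) ℕ.* (isqrt a ℕ.* isqrt a)    ≤⟨ ℕ.*-monoʳ-≤ (p ℕ.* p) (isqrt-lower a) ⟩
  p ℕ.* p ℕ.* a                          <⟨ isqrt-upper (p ℕ.* p ℕ.* a) ⟩
  suc (isqrt (p ℕ.* p ℕ.* a)) ℕ.* suc (isqrt (p ℕ.* p ℕ.* a)) ∎))
  where open ℕ.≤-Reasoning

isqrt-scale-upper : ∀ p a → isqrt (suc p ℕ.* suc p ℕ.* a) ℕ.< suc p ℕ.* suc (isqrt a)
isqrt-scale-upper p a = square-cancel-< (begin-strict
  isqrt (q ℕ.* q ℕ.* a) ℕ.* isqrt (q ℕ.* q ℕ.* a)    ≤⟨ isqrt-lower (q ℕ.* q ℕ.* a) ⟩
  q ℕ.* q ℕ.* a                                      <⟨ ℕ.*-monoʳ-< (q ℕ.* q) (isqrt-upper a) ⟩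
  q ℕ.* q ℕ.* (suc (isqrt a) ℕ.* suc (isqrt a))      ≡⟨ square-* q (suc (isqrt a)) ⟨
  (q ℕ.* suc (isqrt a)) ℕ.* (q ℕ.* suc (isqrt a))    ∎)
  where
  open ℕ.≤-Reasoning
  q = suc p

-- With q = p + 1, s = n + 1 and a = h s², the root of q² a lies between q times the root of a and q
-- times its successor. After division by s the error is between 0 and q / s, which tends to 0.
√seq-scale : ∀ p h → √seq (suc p ℕ.* suc p ℕ.* h) ~ (λ n → fromℕ (suc p) ℚ.* √seq h n)
√seq-scale p h ε 0<ε = ℚ.↧ₙ η , λ n N≤n → ℚ.≤-trans (close n)
  (ℚ.≤-trans (ℚ.*-monoˡ-≤-nonNeg r (archimedes η (proj₁ (proj₂ step)) n N≤n)) (ℚ.≤-reflexive (proj₂ (proj₂ step))))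
  where
  open ℚ.≤-Reasoning
  q = suc p
  r = fromℕ q
  instance
    r-nonNeg : ℚ.NonNegative r
    r-nonNeg = ℚ.pos⇒nonNeg r {{ℚ.positive (0<fromℕ p)}}
  step = scale r ε (0<fromℕ p) 0<ε
  η = proj₁ step
  module _ (n : ℕ) where
    a = h ℕ.* (suc n ℕ.* suc n)
    y = √seq h n
    x = √seq (q ℕ.* q ℕ.* h) n
    x≡ : x ≡ ℤ.+ isqrt (q ℕ.* q ℕ.* a) ℚ./ suc n
    x≡ = cong (λ z → ℤ.+ isqrt z ℚ./ suc n) (ℕ.*-assoc (q ℕ.* q) h (suc n ℕ.* suc n))
    lower : r ℚ.* y ℚ.≤ x
    lower = begin
      r ℚ.* y                                   ≡⟨ fromℕ-*-/ q (isqrt a) n ⟩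
      ℤ.+ (q ℕ.* isqrt a) ℚ./ suc n             ≤⟨ /-monoˡ-≤ n (isqrt-scale-lower q a) ⟩
      ℤ.+ isqrt (q ℕ.* q ℕ.* a) ℚ./ suc n       ≡⟨ x≡ ⟨
      x                                         ∎
    upper : x ℚ.≤ r ℚ.* y ℚ.+ r ℚ.* (ℤ.+ 1 ℚ./ suc n)
    upper = begin
      x                                         ≡⟨ x≡ ⟩
      ℤ.+ isqrt (q ℕ.* q ℕ.* a) ℚ./ suc n       ≤⟨ /-monoˡ-≤ n (ℕ.<⇒≤ (isqrt-scale-upper p a)) ⟩
      ℤ.+ (q ℕ.* suc (isqrt a)) ℚ./ suc n       ≡⟨ fromℕ-*-/ q (suc (isqrt a)) n ⟨
      r ℚ.* (ℤ.+ suc (isqrt a) ℚ./ suc n)       ≡⟨ cong (r ℚ.*_) (suc-/ (isqrt a) n) ⟩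
      r ℚ.* (y ℚ.+ ℤ.+ 1 ℚ./ suc n)             ≡⟨ ℚ.*-distribˡ-+ r y (ℤ.+ 1 ℚ./ suc n) ⟩
      r ℚ.* y ℚ.+ r ℚ.* (ℤ.+ 1 ℚ./ suc n)       ∎
    0≤x-ry : 0ℚ ℚ.≤ x ℚ.- r ℚ.* y
    0≤x-ry = ℚ.≤-trans (ℚ.≤-reflexive (sym (ℚ.+-inverseʳ (r ℚ.* y)))) (ℚ.+-monoˡ-≤ (ℚ.- (r ℚ.* y)) lower)
    close : ℚ.∣ x ℚ.- r ℚ.* y ∣ ℚ.≤ r ℚ.* (ℤ.+ 1 ℚ./ suc n)
    close = begin
      ℚ.∣ x ℚ.- r ℚ.* y ∣                       ≡⟨ ℚ.0≤p⇒∣p∣≡p 0≤x-ry ⟩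
      x ℚ.- r ℚ.* y                             ≤⟨ ℚ.+-monoˡ-≤ (ℚ.- (r ℚ.* y)) upper ⟩
      (r ℚ.* y ℚ.+ r ℚ.* (ℤ.+ 1 ℚ./ suc n)) ℚ.- r ℚ.* y    ≡⟨ p+q-p≡q (r ℚ.* y) (r ℚ.* (ℤ.+ 1 ℚ./ suc n)) ⟩
      r ℚ.* (ℤ.+ 1 ℚ./ suc n)                   ∎

-- This covers negative g too, where √ takes the value √ 0.
√-scale : ∀ p g → seq (√ (ℤ.+ (suc p ℕ.* suc p) ℤ.* g)) ~ (λ n → fromℕ (suc p) ℚ.* seq (√ g) n)
√-scale p (ℤ.+ h) = subst (λ z → seq (√ z) ~ (λ n → fromℕ (suc p) ℚ.* √seq h n))
  (ℤ.pos-* (suc p ℕ.* suc p) h) (√seq-scale p h)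
√-scale p -[1+ h ] = subst (λ z → √seq z ~ (λ n → fromℕ (suc p) ℚ.* √seq 0 n))
  (ℕ.*-zeroʳ (suc p ℕ.* suc p)) (√seq-scale p 0)

isqrt-square : ∀ q → isqrt (q ℕ.* q) ≡ q
isqrt-square q = ℕ.≤-antisym
  (ℕ.s≤s⁻¹ (square-cancel-< (ℕ.≤-<-trans (isqrt-lower (q ℕ.* q)) (ℕ.*-mono-< {q} {suc q} {q} {suc q} ℕ.≤-refl ℕ.≤-refl))))
  (ℕ.s≤s⁻¹ (square-cancel-< (isqrt-upper (q ℕ.* q))))

√seq-1 : ∀ n → √seq 1 n ≡ 1ℚ
√seq-1 n = trans (cong (λ z → ℤ.+ z ℚ./ suc n) (trans (cong isqrt (ℕ.+-identityʳ (suc n ℕ.* suc n))) (isqrt-square (suc n))))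
  (ℚ.≤-antisym (/-mono-≤ (ℤ.+ suc n) n 1ℤ 0 (ℤ.≤-reflexive (ℤ.*-comm (ℤ.+ suc n) 1ℤ)))
               (/-mono-≤ 1ℤ 0 (ℤ.+ suc n) n (ℤ.≤-reflexive (ℤ.*-comm 1ℤ (ℤ.+ suc n)))))

i*i≡∣i∣*∣i∣ : ∀ i → i ℤ.* i ≡ ℤ.+ (∣ i ∣ ℕ.* ∣ i ∣)
i*i≡∣i∣*∣i∣ (ℤ.+ n)  = sym (ℤ.pos-* n n)
i*i≡∣i∣*∣i∣ -[1+ n ] = refl

-- Here `c` stands for the determinant of a column lattice, equal to |w|. Writing |w| as `suc p`
-- makes division by `c` the inverse of `√-scale`.
module _ (w : ℤ) (w≢0 : w ≢ 0ℤ) (c : ℝ) (c≈ : c ≈ √ (w ℤ.* w)) where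

  private
    p : ℕ
    p = ℕ.pred ∣ w ∣

    ∣w∣≡suc : ∣ w ∣ ≡ suc p
    ∣w∣≡suc = sym (ℕ.suc-pred ∣ w ∣ {{ℕ.≢-nonZero (w≢0 ∘ ℤ.∣i∣≡0⇒i≡0)}})

    square≡ : w ℤ.* w ≡ ℤ.+ (suc p ℕ.* suc p)
    square≡ = trans (i*i≡∣i∣*∣i∣ w) (cong (λ z → ℤ.+ (z ℕ.* z)) ∣w∣≡suc)

    √w²~ : ∀ g → seq (√ (w ℤ.* w ℤ.* g)) ~ (λ n → fromℕ (suc p) ℚ.* seq (√ g) n)
    √w²~ g = subst (λ z → seq (√ (z ℤ.* g)) ~ (λ n → fromℕ (suc p) ℚ.* seq (√ g) n)) (sym square≡) (√-scale p g)

    c~ : seq c ~ (λ _ → fromℕ (suc p))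
    -- Scaling √ 1, which is constantly 1, shows that √ (w²) tends to the rational number |w|.
    c~ = ~-trans (seq c) (seq (√ (w ℤ.* w ℤ.* 1ℤ))) r (subst (λ z → seq c ~ seq (√ z)) (sym (ℤ.*-identityʳ (w ℤ.* w))) c≈)
        (~-trans (seq (√ (w ℤ.* w ℤ.* 1ℤ))) (λ n → fromℕ (suc p) ℚ.* √seq 1 n) r (√w²~ 1ℤ) (≗⇒~ λ n →
          trans (cong (fromℕ (suc p) ℚ.*_) (√seq-1 n)) (ℚ.*-identityʳ (fromℕ (suc p)))))
      where
      r : ℕ → ℚ
      r _ = fromℕ (suc p)

  √-square-#0 : c #0
  √-square-#0 = ~-const⇒#0 c (0<fromℕ p) c~

  √-quotient : ∀ x g → x ≈ √ (w ℤ.* w ℤ.* g) → ∀ (c#0 : c #0) → x / c ⟨ c#0 ⟩ ≈ √ g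
  √-quotient x g x≈ = quotient-limit x c (√ g) c~
    (~-trans (seq x) (seq (√ (w ℤ.* w ℤ.* g))) (λ n → fromℕ (suc p) ℚ.* seq (√ g) n) x≈ (√w²~ g))

-- Matrices

open ≡-Reasoning

infix 4 _≐_

_≐_ : ∀ {m n} → Matrix m n → Matrix m n → Set
M ≐ N = ∀ i j → M i j ≡ N i j

I : ∀ {n} → Matrix n n
I zero    zero    = 1ℤ
I zero    (suc j) = 0ℤ
I (suc i) zero    = 0ℤ
I (suc i) (suc j) = I i j

sum-zero : ∀ {n} {v : Vector ℤ n} → (∀ i → v i ≡ 0ℤ) → sum v ≡ 0ℤ
sum-zero {n} v≗0 = trans (sum-cong-≗ v≗0) (sum-replicate-zero n)

sum-linear : ∀ {n} t {w u v : Vector ℤ n} → (∀ i → w i ≡ u i + t * v i) → sum w ≡ sum u + t * sum v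
sum-linear t {w} {u} {v} w≗ = begin
  sum w                          ≡⟨ sum-cong-≗ w≗ ⟩
  sum (λ i → u i + t * v i)      ≡⟨ ∑-distrib-+ u (λ i → t * v i) ⟩
  sum u + sum (λ i → t * v i)    ≡⟨ cong (sum u +_) (*-distribˡ-sum t v) ⟨
  sum u + t * sum v              ∎

-- Alternating multilinear functions of the rows of a matrix

-- Adjacency suits expansion along the first row: deleting either of two equal neighbouring columns
-- leaves the same minor, and the two signs are opposite. Equality with a remote row is handled by
-- swaps in `alternates-head`.
data Adjacent : ∀ {n} → Fin n → Fin n → Set where
  here  : ∀ {n} → Adjacent {suc (suc n)} zero (suc zero)
  there : ∀ {n} {i j : Fin n} → Adjacent i j → Adjacent (suc i) (suc j)

AgreeOff : ∀ {m n} → Fin m → Matrix m n → Matrix m n → Set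
AgreeOff i M N = ∀ l → l ≢ i → ∀ j → M l j ≡ N l j

-- Matrices are functions compared pointwise, hence `respects`, and `linear` relates three matrices
-- instead of updating one. The single shape U + t V covers both sums and multiples.
record IsAlternating {m n} (f : Matrix m n → ℤ) : Set where
  field
    respects   : ∀ {M N} → M ≐ N → f M ≡ f N
    linear     : ∀ i t {M U V} → AgreeOff i M U → AgreeOff i M V →
                 (∀ j → M i j ≡ U i j + t * V i j) → f M ≡ f U + t * f V
    alternates : ∀ {i l} → Adjacent i l → ∀ {M} → (∀ j → M i j ≡ M l j) → f M ≡ 0ℤ

open IsAlternating

private variable
  k l m n r : ℕ

agreeHead : ∀ {w u : Vector ℤ n} {R : Matrix m n} → AgreeOff zero (w ∷ R) (u ∷ R)
agreeHead zero    0≢0 = contradiction refl 0≢0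
agreeHead (suc l) _ j = refl

agreeSecond : ∀ {w u v : Vector ℤ n} {R : Matrix m n} → AgreeOff (suc zero) (v ∷ w ∷ R) (v ∷ u ∷ R)
agreeSecond zero          _ j = refl
agreeSecond (suc zero)    1≢1 = contradiction refl 1≢1
agreeSecond (suc (suc l)) _ j = refl

∷-cong : ∀ {u v : Vector ℤ n} {M N : Matrix m n} → u ≗ v → M ≐ N → u ∷ M ≐ v ∷ N
∷-cong u≗v M≐N zero    = u≗v
∷-cong u≗v M≐N (suc i) = M≐N i

∷-agree : ∀ {v : Vector ℤ n} {M N : Matrix m n} {i} →
          AgreeOff i M N → AgreeOff (suc i) (v ∷ M) (v ∷ N)
∷-agree M~N zero    _   j = refl
∷-agree M~N (suc l) l≢i j = M~N l (l≢i ∘ cong suc) j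

∷-alternating : ∀ {f : Matrix (suc m) n → ℤ} → IsAlternating f → ∀ v → IsAlternating (λ M → f (v ∷ M))
∷-alternating alt v = record
  { respects   = λ M≐N → respects alt (∷-cong (λ _ → refl) M≐N)
  ; linear     = λ i t M~U M~V → linear alt (suc i) t (∷-agree M~U) (∷-agree M~V)
  ; alternates = λ adj → alternates alt (there adj)
  }

insertAt-linear : ∀ t {w u v : Vector ℤ n} j {a b c} → (∀ i → w i ≡ u i + t * v i) → a ≡ b + t * c →
                  ∀ x → insertAt w j a x ≡ insertAt u j b x + t * insertAt v j c x
insertAt-linear t zero    w≗ a≡ zero    = a≡
insertAt-linear t zero    w≗ a≡ (suc x) = w≗ x
insertAt-linear {suc n} t (suc j) w≗ a≡ zero    = w≗ zero
insertAt-linear {suc n} t (suc j) w≗ a≡ (suc x) = insertAt-linear t j (w≗ ∘ suc) a≡ x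

insertAt-cong : ∀ {u v : Vector ℤ n} j {a} → u ≗ v → insertAt u j a ≗ insertAt v j a
insertAt-cong zero    u≗v zero    = refl
insertAt-cong zero    u≗v (suc x) = u≗v x
insertAt-cong {suc n} (suc j) u≗v zero    = u≗v zero
insertAt-cong {suc n} (suc j) u≗v (suc x) = insertAt-cong j (u≗v ∘ suc) x

insertAt-zeros : ∀ (j : Fin (suc n)) → insertAt (λ _ → 0ℤ) j 1ℤ ≗ I j
insertAt-zeros zero    zero    = refl
insertAt-zeros zero    (suc x) = refl
insertAt-zeros {suc n} (suc j) zero    = refl
insertAt-zeros {suc n} (suc j) (suc x) = insertAt-zeros j x

insertAt-I : ∀ (j : Fin (suc n)) i → insertAt (I i) j 0ℤ ≗ I (punchIn j i)
insertAt-I zero    i       zero    = refl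
insertAt-I zero    i       (suc x) = refl
insertAt-I (suc j) zero    zero    = refl
insertAt-I (suc j) (suc i) zero    = refl
insertAt-I {suc (suc n)} (suc j) (suc i) (suc x) = insertAt-I j i x
insertAt-I {suc n} (suc j) zero (suc x) = zeros j x
  where
  zeros : ∀ {n} (j : Fin (suc n)) → insertAt (λ _ → 0ℤ) j 0ℤ ≗ (λ _ → 0ℤ)
  zeros zero    zero    = refl
  zeros zero    (suc x) = refl
  zeros {suc n} (suc j) zero    = refl
  zeros {suc n} (suc j) (suc x) = zeros j x

-- This drives the descent in size: once a row e_j is split off and column j is cleared, an
-- alternating function of large matrices becomes one of their minors.
insertColumn-alternating : ∀ {f : Matrix m (suc n) → ℤ} → IsAlternating f → ∀ j →
                           IsAlternating (λ M → f (λ i → insertAt (M i) j 0ℤ))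
insertColumn-alternating alt j = record
  { respects   = λ M≐N → respects alt (λ i → insertAt-cong j (M≐N i))
  ; linear     = λ i t M~U M~V Mi≗ → linear alt i t
      (λ l l≢i → insertAt-cong j (M~U l l≢i)) (λ l l≢i → insertAt-cong j (M~V l l≢i))
      (insertAt-linear t j Mi≗ (sym (trans (ℤ.+-identityˡ _) (ℤ.*-zeroʳ t))))
  ; alternates = λ adj Mi≗Ml → alternates alt adj (insertAt-cong j Mi≗Ml)
  }

-- Polarisation: expand f at two rows both equal to u + v, where it vanishes, and discard the terms
-- with a repeated row.
swap : ∀ {f : Matrix (suc (suc m)) n → ℤ} → IsAlternating f → ∀ u v R →
       f (u ∷ v ∷ R) ≡ - f (v ∷ u ∷ R)
swap {f = f} alt u v R = isolate (f (u ∷ u ∷ R)) (f (v ∷ v ∷ R)) (f (v ∷ u ∷ R))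
  (alternates alt here (λ _ → refl)) (alternates alt here (λ _ → refl)) (begin
  0ℤ
    ≡⟨ alternates alt here (λ _ → refl) ⟨
  f (s ∷ s ∷ R)
    ≡⟨ linear alt zero 1ℤ agreeHead agreeHead (λ _ → refl) ⟩
  f (u ∷ s ∷ R) + 1ℤ * f (v ∷ s ∷ R)
    ≡⟨ cong₂ (λ a b → a + 1ℤ * b) (linear alt (suc zero) 1ℤ agreeSecond agreeSecond (λ _ → refl))
                                  (linear alt (suc zero) 1ℤ agreeSecond agreeSecond (λ _ → refl)) ⟩
  (f (u ∷ u ∷ R) + 1ℤ * f (u ∷ v ∷ R)) + 1ℤ * (f (v ∷ u ∷ R) + 1ℤ * f (v ∷ v ∷ R)) ∎)
  where
  s : Vector ℤ _
  s j = u j + 1ℤ * v j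
  isolate : ∀ a b c {d} → a ≡ 0ℤ → b ≡ 0ℤ → 0ℤ ≡ (a + 1ℤ * d) + 1ℤ * (c + 1ℤ * b) → d ≡ - c
  isolate a b c {d} a≡0 b≡0 eq = begin
    d                                            ≡⟨ rearrange a b c d ⟩
    ((a + 1ℤ * d) + 1ℤ * (c + 1ℤ * b)) - a - b - c
      ≡⟨ cong (λ z → z - a - b - c) eq ⟨
    0ℤ - a - b - c                               ≡⟨ cong₂ (λ x y → 0ℤ - x - y - c) a≡0 b≡0 ⟩
    0ℤ - 0ℤ - 0ℤ - c                             ≡⟨ ℤ.+-identityˡ (- c) ⟩
    - c                                          ∎
    where
    rearrange : ∀ a b c d → d ≡ ((a + 1ℤ * d) + 1ℤ * (c + 1ℤ * b)) - a - b - c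
    rearrange = solve-∀

-- Swaps carry `v` down until it is adjacent to its equal; each swap only changes the sign.
alternates-head : ∀ {f : Matrix (suc m) n → ℤ} → IsAlternating f → ∀ v M i →
                  (∀ j → v j ≡ M i j) → f (v ∷ M) ≡ 0ℤ
alternates-head alt v M zero    v≗Mi = alternates alt here v≗Mi
alternates-head {f = f} alt v M (suc i) v≗Mi = begin
  f (v ∷ M)                        ≡⟨ respects alt (∷-cong (λ _ → refl) (λ { zero _ → refl ; (suc l) _ → refl })) ⟩
  f (v ∷ M zero ∷ tail M)          ≡⟨ swap alt v (M zero) (tail M) ⟩
  - f (M zero ∷ v ∷ tail M)        ≡⟨ cong -_ (alternates-head (∷-alternating alt (M zero)) v (tail M) i v≗Mi) ⟩
  0ℤ                               ∎

-- Rows are treated one at a time, and each change is a multiple of a value with `u` among the rows.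
-- In use, `u` is a unit vector fixed as first row, and the multiples clear its column.
addMultiples : ∀ {f : Matrix m n → ℤ} → IsAlternating f → ∀ (u : Vector ℤ n) →
               (∀ M i → (∀ j → u j ≡ M i j) → f M ≡ 0ℤ) →
               ∀ {M N} (a : Vector ℤ m) → (∀ i j → M i j ≡ N i j + a i * u j) → f M ≡ f N
addMultiples {zero}          alt u kills a M≗ = respects alt (λ ())
addMultiples {suc m} {f = f} alt u kills {M} {N} a M≗ = begin
  f M
    ≡⟨ linear alt zero (a zero) agree agree (M≗ zero) ⟩
  f (N zero ∷ tail M) + a zero * f (u ∷ tail M)
    ≡⟨ cong (λ z → f (N zero ∷ tail M) + a zero * z) (kills (u ∷ tail M) zero (λ _ → refl)) ⟩
  f (N zero ∷ tail M) + a zero * 0ℤ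
    ≡⟨ cong (f (N zero ∷ tail M) +_) (ℤ.*-zeroʳ (a zero)) ⟩
  f (N zero ∷ tail M) + 0ℤ
    ≡⟨ ℤ.+-identityʳ _ ⟩
  f (N zero ∷ tail M)
    ≡⟨ addMultiples (∷-alternating alt (N zero)) u (λ R i → kills (N zero ∷ R) (suc i)) (a ∘ suc) (M≗ ∘ suc) ⟩
  f (N zero ∷ tail N)
    ≡⟨ respects alt (λ { zero _ → refl ; (suc l) _ → refl }) ⟩
  f N ∎
  where
  agree : ∀ {v} → AgreeOff zero M (v ∷ tail M)
  agree zero    0≢0 = contradiction refl 0≢0
  agree (suc l) _ j = refl

linear-expand : ∀ (g : Vector ℤ n → ℤ) →
                (∀ t {w u v} → (∀ j → w j ≡ u j + t * v j) → g w ≡ g u + t * g v) →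
                ∀ v → g v ≡ sum (λ j → v j * g (I j))
-- All vectors of length 0 agree, so `lin` with t = 1 makes g v equal to its own double.
linear-expand {zero}  g lin v = cancel (lin 1ℤ {v} {v} {v} (λ ()))
  where
  cancel : ∀ {x} → x ≡ x + 1ℤ * x → x ≡ 0ℤ
  cancel {x} eq = begin
    x                    ≡⟨ shift x ⟩
    (x + 1ℤ * x) - x     ≡⟨ cong (_- x) eq ⟨
    x - x                ≡⟨ ℤ.+-inverseʳ x ⟩
    0ℤ                   ∎
    where
    shift : ∀ x → x ≡ (x + 1ℤ * x) - x
    shift = solve-∀
linear-expand {suc n} g lin v = begin
  g v
    ≡⟨ lin (v zero) split ⟩
  g (0ℤ ∷ tail v) + v zero * g (I zero)
    ≡⟨ cong (_+ v zero * g (I zero)) (linear-expand (g ∘ (0ℤ ∷_)) lin′ (tail v)) ⟩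
  sum (λ j → v (suc j) * g (0ℤ ∷ I j)) + v zero * g (I zero)
    ≡⟨ cong (_+ v zero * g (I zero)) (sum-cong-≗ λ j → cong (v (suc j) *_)
         (g-cong {0ℤ ∷ I j} {I (suc j)} (λ { zero → refl ; (suc x) → refl }))) ⟩
  sum (λ j → v (suc j) * g (I (suc j))) + v zero * g (I zero)
    ≡⟨ ℤ.+-comm _ (v zero * g (I zero)) ⟩
  v zero * g (I zero) + sum (λ j → v (suc j) * g (I (suc j))) ∎
  where
  split : ∀ j → v j ≡ (0ℤ ∷ tail v) j + v zero * I zero j
  split zero    = sym (trans (ℤ.+-identityˡ _) (ℤ.*-identityʳ _))
  split (suc j) = sym (trans (cong (v (suc j) +_) (ℤ.*-zeroʳ (v zero))) (ℤ.+-identityʳ _))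
  lin′ : ∀ t {w u v} → (∀ j → w j ≡ u j + t * v j) → g (0ℤ ∷ w) ≡ g (0ℤ ∷ u) + t * g (0ℤ ∷ v)
  lin′ t w≗ = lin t λ { zero → sym (trans (ℤ.+-identityˡ _) (ℤ.*-zeroʳ t)) ; (suc j) → w≗ j }
  -- Congruence is the case t = 0 of `lin`.
  g-cong : ∀ {u w} → u ≗ w → g u ≡ g w
  g-cong {u} {w} u≗w = trans (lin 0ℤ {u} {w} {w} (λ j → trans (u≗w j) (sym (ℤ.+-identityʳ _)))) (ℤ.+-identityʳ _)

-- Moving e_j to its place takes j neighbour swaps. After one swap e_0 leads; freezing it and
-- removing the zero column 0 leaves the same problem one size smaller.
alternating-I : ∀ {f : Matrix (suc n) (suc n) → ℤ} → IsAlternating f → ∀ j →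
                f (I j ∷ λ i → I (punchIn j i)) ≡ sign j * f I
alternating-I {f = f} alt zero =
  trans (respects alt (λ { zero _ → refl ; (suc i) _ → refl })) (sym (ℤ.*-identityˡ (f I)))
alternating-I {suc n} {f} alt (suc j) = begin
  f (I (suc j) ∷ λ i → I (punchIn (suc j) i))
    ≡⟨ respects alt (λ { zero _ → refl ; (suc zero) _ → refl ; (suc (suc i)) _ → refl }) ⟩
  f (I (suc j) ∷ I zero ∷ λ i → I (suc (punchIn j i)))
    ≡⟨ swap alt (I (suc j)) (I zero) _ ⟩
  - f (I zero ∷ I (suc j) ∷ λ i → I (suc (punchIn j i)))
    ≡⟨ cong -_ (respects alt (∷-cong (λ _ → refl) λ { zero x → sym (insertAt-I zero j x)
                                                  ; (suc i) x → sym (insertAt-I zero (punchIn j i) x) })) ⟩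
  - h (I j ∷ λ i → I (punchIn j i))
    ≡⟨ cong -_ (alternating-I (insertColumn-alternating (∷-alternating alt (I zero)) zero) j) ⟩
  - (sign j * h I)
    ≡⟨ ℤ.neg-distribˡ-* (sign j) (h I) ⟩
  - sign j * h I
    ≡⟨ cong (- sign j *_) (respects alt λ { zero _ → refl ; (suc i) x → insertAt-I zero i x }) ⟩
  - sign j * f I ∎
  where
  h : Matrix (suc n) (suc n) → ℤ
  h N = f (I zero ∷ λ i → insertAt (N i) zero 0ℤ)

-- Expand the first row; once it is e_j, column j of the other rows can be cleared.
alternating-unique : ∀ {f : Matrix n n → ℤ} → IsAlternating f → ∀ M → f M ≡ det M * f I
alternating-unique {zero}  {f} alt M = trans (respects alt (λ ())) (sym (ℤ.*-identityˡ (f I)))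
alternating-unique {suc n} {f} alt M = begin
  f M
    ≡⟨ respects alt (λ { zero _ → refl ; (suc i) _ → refl }) ⟩
  f (M zero ∷ tail M)
    ≡⟨ linear-expand (λ v → f (v ∷ tail M)) (λ t → linear alt zero t agreeHead agreeHead) (M zero) ⟩
  sum (λ j → M zero j * f (I j ∷ tail M))
    ≡⟨ sum-cong-≗ term ⟩
  sum (λ j → sign j * M zero j * det (minor j) * f I)
    ≡⟨ *-distribʳ-sum (f I) (λ j → sign j * M zero j * det (minor j)) ⟨
  det M * f I ∎
  where
  minor : Fin (suc n) → Matrix n n
  minor j i l = M (suc i) (punchIn j l)
  h : Fin (suc n) → Matrix n n → ℤ
  h j N = f (I j ∷ λ i → insertAt (N i) j 0ℤ)
  -- A row is its minor row with the entry of column j put back; splitting that entry off as a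
  -- multiple of e_j leaves 0 in its place.
  clear : ∀ j i x → M (suc i) x ≡ insertAt (minor j i) j 0ℤ x + M (suc i) j * I j x
  clear j i x = begin
    M (suc i) x
      ≡⟨ insertAt-removeAt (M (suc i)) j x ⟨
    insertAt (minor j i) j a x
      ≡⟨ insertAt-linear a {u = minor j i} {v = λ _ → 0ℤ} j (λ l → sym (trans (cong (minor j i l +_) (ℤ.*-zeroʳ a)) (ℤ.+-identityʳ _)))
                         (sym (trans (ℤ.+-identityˡ _) (ℤ.*-identityʳ a))) x ⟩
    insertAt (minor j i) j 0ℤ x + a * insertAt (λ _ → 0ℤ) j 1ℤ x
      ≡⟨ cong (λ z → insertAt (minor j i) j 0ℤ x + a * z) (insertAt-zeros j x) ⟩
    insertAt (minor j i) j 0ℤ x + a * I j x ∎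
    where a = M (suc i) j
  reassoc : ∀ a s d z → a * (d * (s * z)) ≡ s * a * d * z
  reassoc = solve-∀
  term : ∀ j → M zero j * f (I j ∷ tail M) ≡ sign j * M zero j * det (minor j) * f I
  term j = begin
    M zero j * f (I j ∷ tail M)
      ≡⟨ cong (M zero j *_) (addMultiples (∷-alternating alt (I j)) (I j) (alternates-head alt (I j)) (λ i → M (suc i) j) (clear j)) ⟩
    M zero j * h j (minor j)
      ≡⟨ cong (M zero j *_) (alternating-unique (insertColumn-alternating (∷-alternating alt (I j)) j) (minor j)) ⟩
    M zero j * (det (minor j) * h j I)
      ≡⟨ cong (λ z → M zero j * (det (minor j) * z)) (respects alt (∷-cong (λ _ → refl) (insertAt-I j))) ⟩
    M zero j * (det (minor j) * f (I j ∷ λ i → I (punchIn j i)))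
      ≡⟨ cong (λ z → M zero j * (det (minor j) * z)) (alternating-I alt j) ⟩
    M zero j * (det (minor j) * (sign j * f I))
      ≡⟨ reassoc (M zero j) (sign j) (det (minor j)) (f I) ⟩
    sign j * M zero j * det (minor j) * f I ∎

-- Determinants

det-cong : ∀ {M N : Matrix n n} → M ≐ N → det M ≡ det N
det-cong {zero}  M≐N = refl
det-cong {suc n} M≐N = sum-cong-≗ λ j → cong₂ _*_ (cong (sign j *_) (M≐N zero j))
                                                   (det-cong λ i l → M≐N (suc i) (punchIn j l))

-- Columns come first because expansion along row 0 treats them alike. The term at j = c is linear
-- through its entry, its minor omitting column c; every other term is linear through its minor,
-- where c survives as `punchOut j≢c`.
det-column-linear : ∀ c t {M U V : Matrix n n} →
                    (∀ i l → l ≢ c → M i l ≡ U i l) → (∀ i l → l ≢ c → M i l ≡ V i l) →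
                    (∀ i → M i c ≡ U i c + t * V i c) → det M ≡ det U + t * det V
det-column-linear {suc n} c t {M} {U} {V} M~U M~V Mc≡ = sum-linear t {u = laplace U} {laplace V} term
  where
  minor : Matrix (suc n) (suc n) → Fin (suc n) → Matrix n n
  minor N j i l = N (suc i) (punchIn j l)
  laplace : Matrix (suc n) (suc n) → Vector ℤ (suc n)
  laplace N j = sign j * N zero j * det (minor N j)
  distrib : ∀ s u v d t → s * (u + t * v) * d ≡ s * u * d + t * (s * v * d)
  distrib = solve-∀
  distrib′ : ∀ s a d e t → s * a * (d + t * e) ≡ s * a * d + t * (s * a * e)
  distrib′ = solve-∀
  term : ∀ j → laplace M j ≡ laplace U j + t * laplace V j
  term j with j Fin.≟ c
  ... | yes refl = begin
    sign j * M zero j * det (minor M j)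
      ≡⟨ cong (λ z → sign j * z * det (minor M j)) (Mc≡ zero) ⟩
    sign j * (U zero j + t * V zero j) * det (minor M j)
      ≡⟨ distrib (sign j) (U zero j) (V zero j) (det (minor M j)) t ⟩
    sign j * U zero j * det (minor M j) + t * (sign j * V zero j * det (minor M j))
      ≡⟨ cong₂ (λ x y → sign j * U zero j * x + t * (sign j * V zero j * y))
           (det-cong λ i l → M~U (suc i) (punchIn j l) (Fin.punchInᵢ≢i j l))
           (det-cong λ i l → M~V (suc i) (punchIn j l) (Fin.punchInᵢ≢i j l)) ⟩
    sign j * U zero j * det (minor U j) + t * (sign j * V zero j * det (minor V j)) ∎
  ... | no j≢c = begin
    sign j * M zero j * det (minor M j)
      ≡⟨ cong (sign j * M zero j *_) (det-column-linear c′ t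
           (λ i l l≢c′ → M~U (suc i) (punchIn j l) (off l l≢c′))
           (λ i l l≢c′ → M~V (suc i) (punchIn j l) (off l l≢c′))
           (λ i → subst (λ x → M (suc i) x ≡ U (suc i) x + t * V (suc i) x) (sym c≡) (Mc≡ (suc i)))) ⟩
    sign j * M zero j * (det (minor U j) + t * det (minor V j))
      ≡⟨ distrib′ (sign j) (M zero j) (det (minor U j)) (det (minor V j)) t ⟩
    sign j * M zero j * det (minor U j) + t * (sign j * M zero j * det (minor V j))
      ≡⟨ cong₂ (λ x y → sign j * x * det (minor U j) + t * (sign j * y * det (minor V j)))
           (M~U zero j j≢c) (M~V zero j j≢c) ⟩
    sign j * U zero j * det (minor U j) + t * (sign j * V zero j * det (minor V j)) ∎
    where
    c′ = punchOut j≢c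
    c≡ : punchIn j c′ ≡ c
    c≡ = Fin.punchIn-punchOut j≢c
    off : ∀ l → l ≢ c′ → punchIn j l ≢ c
    off l l≢c′ eq = l≢c′ (Fin.punchIn-injective j l c′ (trans eq (sym c≡)))

sum-adjacent : ∀ {a b : Fin n} → Adjacent a b → ∀ {v : Vector ℤ n} → v a + v b ≡ 0ℤ →
               (∀ j → j ≢ a → j ≢ b → v j ≡ 0ℤ) → sum v ≡ 0ℤ
sum-adjacent here {v} pair rest = begin
  v zero + (v (suc zero) + sum (λ j → v (suc (suc j))))
    ≡⟨ cong (λ z → v zero + (v (suc zero) + z)) (sum-zero λ j → rest (suc (suc j)) (λ ()) (λ ())) ⟩
  v zero + (v (suc zero) + 0ℤ)
    ≡⟨ cong (v zero +_) (ℤ.+-identityʳ _) ⟩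
  v zero + v (suc zero)
    ≡⟨ pair ⟩
  0ℤ ∎
sum-adjacent (there adj) {v} pair rest = cong₂ _+_ (rest zero (λ ()) (λ ()))
  (sum-adjacent adj {tail v} pair λ j j≢a j≢b → rest (suc j) (j≢a ∘ Fin.suc-injective) (j≢b ∘ Fin.suc-injective))

punchOut-adjacent : ∀ {a b : Fin (suc n)} j → Adjacent a b → j ≢ a → j ≢ b →
                    ∃[ a′ ] ∃[ b′ ] Adjacent a′ b′ × punchIn j a′ ≡ a × punchIn j b′ ≡ b
punchOut-adjacent zero          here j≢a j≢b = contradiction refl j≢a
punchOut-adjacent (suc zero)    here j≢a j≢b = contradiction refl j≢b
punchOut-adjacent {suc (suc n)} (suc (suc j)) here _ _ = zero , suc zero , here , refl , refl
punchOut-adjacent zero (there adj) _ _ = _ , _ , adj , refl , refl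
punchOut-adjacent {suc n} (suc j) (there adj) j≢a j≢b
  with punchOut-adjacent j adj (j≢a ∘ cong suc) (j≢b ∘ cong suc)
... | a′ , b′ , adj′ , a≡ , b≡ = suc a′ , suc b′ , there adj′ , cong suc a≡ , cong suc b≡

sign-adjacent : ∀ {a b : Fin n} → Adjacent a b → sign b ≡ - sign a
sign-adjacent here        = refl
sign-adjacent (there adj) = cong -_ (sign-adjacent adj)

removeAt-adjacent : ∀ {a b : Fin (suc n)} → Adjacent a b → ∀ {v : Vector ℤ (suc n)} → v a ≡ v b →
                    ∀ l → v (punchIn a l) ≡ v (punchIn b l)
removeAt-adjacent here va≡vb zero    = sym va≡vb
removeAt-adjacent here va≡vb (suc l) = refl
removeAt-adjacent {suc n} (there adj) va≡vb zero    = refl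
removeAt-adjacent {suc n} (there adj) {v} va≡vb (suc l) = removeAt-adjacent adj {tail v} va≡vb l

-- The terms at a and b cancel, having equal entries, equal minors and opposite signs. Every other
-- minor still contains two equal adjacent columns and vanishes by induction.
det-column-alternates : ∀ {a b : Fin n} → Adjacent a b → ∀ {M : Matrix n n} →
                        (∀ i → M i a ≡ M i b) → det M ≡ 0ℤ
det-column-alternates {suc n} {a} {b} adj {M} Ma≡Mb = sum-adjacent adj pair rest
  where
  minor : Fin (suc n) → Matrix n n
  minor j i l = M (suc i) (punchIn j l)
  opposite : ∀ s x d → s * x * d + (- s) * x * d ≡ 0ℤ
  opposite = solve-∀
  pair : sign a * M zero a * det (minor a) + sign b * M zero b * det (minor b) ≡ 0ℤ
  pair = begin
    sign a * M zero a * det (minor a) + sign b * M zero b * det (minor b)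
      ≡⟨ cong (λ z → sign a * M zero a * det (minor a) + z) (cong₂ _*_
           (cong₂ _*_ (sign-adjacent adj) (sym (Ma≡Mb zero)))
           (sym (det-cong λ i → removeAt-adjacent adj (Ma≡Mb (suc i))))) ⟩
    sign a * M zero a * det (minor a) + (- sign a) * M zero a * det (minor a)
      ≡⟨ opposite (sign a) (M zero a) (det (minor a)) ⟩
    0ℤ ∎
  rest : ∀ j → j ≢ a → j ≢ b → sign j * M zero j * det (minor j) ≡ 0ℤ
  rest j j≢a j≢b with punchOut-adjacent j adj j≢a j≢b
  ... | a′ , b′ , adj′ , refl , refl =
    trans (cong (sign j * M zero j *_) (det-column-alternates adj′ λ i → Ma≡Mb (suc i)))
          (ℤ.*-zeroʳ (sign j * M zero j))

-- Matrix algebra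

·-cong : ∀ {M M′ : Matrix l m} {N N′ : Matrix m n} → M ≐ M′ → N ≐ N′ → M · N ≐ M′ · N′
·-cong M≐ N≐ i k = sum-cong-≗ λ j → cong₂ _*_ (M≐ i j) (N≐ j k)

·-assoc : ∀ (L : Matrix k l) (M : Matrix l m) (N : Matrix m n) → (L · M) · N ≐ L · (M · N)
·-assoc L M N i j = begin
  sum (λ y → sum (λ x → L i x * M x y) * N y j)
    ≡⟨ sum-cong-≗ (λ y → *-distribʳ-sum (N y j) (λ x → L i x * M x y)) ⟩
  sum (λ y → sum (λ x → L i x * M x y * N y j))
    ≡⟨ ∑-comm (λ y x → L i x * M x y * N y j) ⟩
  sum (λ x → sum (λ y → L i x * M x y * N y j))
    ≡⟨ sum-cong-≗ (λ x → trans (sum-cong-≗ λ y → ℤ.*-assoc (L i x) (M x y) (N y j))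
                               (sym (*-distribˡ-sum (L i x) (λ y → M x y * N y j)))) ⟩
  sum (λ x → L i x * sum (λ y → M x y * N y j)) ∎

ᵀ-· : ∀ (M : Matrix l m) (N : Matrix m n) → (M · N) ᵀ ≐ N ᵀ · M ᵀ
ᵀ-· M N i j = sum-cong-≗ λ x → ℤ.*-comm (M j x) (N x i)

sum-I : ∀ (v : Vector ℤ n) i → sum (λ j → I i j * v j) ≡ v i
sum-I v zero = trans (cong₂ _+_ (ℤ.*-identityˡ (v zero)) (sum-zero λ j → ℤ.*-zeroˡ (v (suc j)))) (ℤ.+-identityʳ (v zero))
sum-I v (suc i) = trans (cong (_+ sum (λ j → I i j * v (suc j))) (ℤ.*-zeroˡ (v zero)))
                        (trans (ℤ.+-identityˡ _) (sum-I (tail v) i))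

I-symmetric : I {n} ᵀ ≐ I
I-symmetric zero    zero    = refl
I-symmetric zero    (suc j) = refl
I-symmetric (suc i) zero    = refl
I-symmetric (suc i) (suc j) = I-symmetric i j

·-identityˡ : ∀ (M : Matrix m n) → I · M ≐ M
·-identityˡ M i j = sum-I (λ x → M x j) i

·-identityʳ : ∀ (M : Matrix m n) → M · I ≐ M
·-identityʳ M i j = begin
  sum (λ x → M i x * I x j)    ≡⟨ sum-cong-≗ (λ x → trans (cong (M i x *_) (sym (I-symmetric x j))) (ℤ.*-comm (M i x) (I j x))) ⟩
  sum (λ x → I j x * M i x)    ≡⟨ sum-I (M i) j ⟩
  M i j                        ∎

det-I : ∀ n → det (I {n}) ≡ 1ℤ
det-I zero    = refl
det-I (suc n) = begin
  1ℤ * 1ℤ * det (I {n}) + sum (λ (j : Fin n) → - sign j * 0ℤ * det (λ i l → I (suc i) (punchIn (suc j) l)))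
    ≡⟨ cong₂ (λ x y → 1ℤ * 1ℤ * x + y) (det-I n)
         (sum-zero λ (j : Fin n) → cong (_* det (λ i l → I (suc i) (punchIn (suc j) l))) (ℤ.*-zeroʳ (- sign j))) ⟩
  1ℤ ∎

-- The rows of M give the columns of C·Mᵀ, so the column properties of det become row properties of
-- this function.
det-·ᵀ-alternating : ∀ (C : Matrix n n) → IsAlternating (λ M → det (C · M ᵀ))
det-·ᵀ-alternating C = record
  { respects   = λ M≐N → det-cong (·-cong {M = C} (λ _ _ → refl) (λ x j → M≐N j x))
  ; linear     = λ i t M~U M~V Mi≗ → det-column-linear i t
      (λ r l l≢i → sum-cong-≗ λ x → cong (C r x *_) (M~U l l≢i x))
      (λ r l l≢i → sum-cong-≗ λ x → cong (C r x *_) (M~V l l≢i x))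
      (λ r → sum-linear t λ x → trans (cong (C r x *_) (Mi≗ x)) (distrib (C r x) _ _ t))
  ; alternates = λ adj Mi≗Ml → det-column-alternates adj λ r → sum-cong-≗ λ x → cong (C r x *_) (Mi≗Ml x)
  }
  where
  distrib : ∀ c u v t → c * (u + t * v) ≡ c * u + t * (c * v)
  distrib = solve-∀

-- Uniqueness applies to M ↦ det (C·Mᵀ), whose value at I is det C. The case C = I then yields
-- transposition, and with it the plain product rule.
det-·ᵀ : ∀ (C M : Matrix n n) → det (C · M ᵀ) ≡ det C * det M
det-·ᵀ C M = begin
  det (C · M ᵀ)            ≡⟨ alternating-unique (det-·ᵀ-alternating C) M ⟩
  det M * det (C · I ᵀ)    ≡⟨ cong (det M *_) (det-cong λ i j →
                                trans (·-cong {M = C} (λ _ _ → refl) I-symmetric i j) (·-identityʳ C i j)) ⟩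
  det M * det C            ≡⟨ ℤ.*-comm (det M) (det C) ⟩
  det C * det M            ∎

det-ᵀ : ∀ (M : Matrix n n) → det (M ᵀ) ≡ det M
det-ᵀ {n} M = begin
  det (M ᵀ)               ≡⟨ det-cong (·-identityˡ (M ᵀ)) ⟨
  det (I · M ᵀ)           ≡⟨ det-·ᵀ I M ⟩
  det (I {n}) * det M     ≡⟨ cong (_* det M) (det-I n) ⟩
  1ℤ * det M              ≡⟨ ℤ.*-identityˡ (det M) ⟩
  det M                   ∎

det-· : ∀ (M N : Matrix n n) → det (M · N) ≡ det M * det N
det-· M N = trans (det-·ᵀ M (N ᵀ)) (cong (det M *_) (det-ᵀ N))

-- Block matrices

sum-++ : ∀ m {n} (v : Vector ℤ (m ℕ.+ n)) → sum v ≡ sum (λ i → v (i ↑ˡ n)) + sum (λ i → v (m ↑ʳ i))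
sum-++ zero    v = sym (ℤ.+-identityˡ (sum v))
sum-++ (suc m) v = trans (cong (v zero +_) (sum-++ m (tail v))) (sym (ℤ.+-assoc (v zero) _ _))

punchIn-↑ˡ : ∀ (j : Fin (suc m)) i → punchIn (j ↑ˡ n) (i ↑ˡ n) ≡ punchIn j i ↑ˡ n
punchIn-↑ˡ zero    i       = refl
punchIn-↑ˡ (suc j) zero    = refl
punchIn-↑ˡ (suc j) (suc i) = cong suc (punchIn-↑ˡ j i)

punchIn-↑ʳ : ∀ (j : Fin (suc m)) (i : Fin n) → punchIn (j ↑ˡ n) (m ↑ʳ i) ≡ suc m ↑ʳ i
punchIn-↑ʳ         zero    i = refl
punchIn-↑ʳ {suc m} (suc j) i = cong suc (punchIn-↑ʳ j i)

sign-↑ˡ : ∀ (j : Fin m) n → sign (j ↑ˡ n) ≡ sign j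
sign-↑ˡ zero    n = refl
sign-↑ˡ (suc j) n = cong -_ (sign-↑ˡ j n)

-- In the first row only the left columns contribute, and their minors are again lower block
-- triangular with the same lower right block.
det-lowerBlock : ∀ m {n} (M : Matrix (m ℕ.+ n) (m ℕ.+ n)) → (∀ i j → M (i ↑ˡ n) (m ↑ʳ j) ≡ 0ℤ) →
                 det M ≡ det (λ i j → M (i ↑ˡ n) (j ↑ˡ n)) * det (λ i j → M (m ↑ʳ i) (m ↑ʳ j))
det-lowerBlock zero        M upper≡0 = sym (ℤ.*-identityˡ (det M))
det-lowerBlock (suc m) {n} M upper≡0 = begin
  det M
    ≡⟨ sum-++ (suc m) term ⟩
  sum (λ j → term (j ↑ˡ n)) + sum (λ j → term (suc m ↑ʳ j))
    ≡⟨ cong₂ _+_ (sum-cong-≗ left) (sum-zero right) ⟩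
  sum (λ j → sign j * P zero j * det (minor P j) * det Q) + 0ℤ
    ≡⟨ ℤ.+-identityʳ _ ⟩
  sum (λ j → sign j * P zero j * det (minor P j) * det Q)
    ≡⟨ *-distribʳ-sum (det Q) (λ j → sign j * P zero j * det (minor P j)) ⟨
  det P * det Q ∎
  where
  minor : ∀ {r} → Matrix (suc r) (suc r) → Fin (suc r) → Matrix r r
  minor N j i l = N (suc i) (punchIn j l)
  P : Matrix (suc m) (suc m)
  P i j = M (i ↑ˡ n) (j ↑ˡ n)
  Q : Matrix n n
  Q i j = M (suc m ↑ʳ i) (suc m ↑ʳ j)
  term : Vector ℤ (suc m ℕ.+ n)
  term j = sign j * M zero j * det (minor M j)
  right : ∀ j → term (suc m ↑ʳ j) ≡ 0ℤ
  right j = begin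
    sign c * M zero c * det (minor M c)
      ≡⟨ cong (λ z → sign c * z * det (minor M c)) (upper≡0 zero j) ⟩
    sign c * 0ℤ * det (minor M c)
      ≡⟨ cong (_* det (minor M c)) (ℤ.*-zeroʳ (sign c)) ⟩
    0ℤ ∎
    where c = suc m ↑ʳ j
  left : ∀ j → term (j ↑ˡ n) ≡ sign j * P zero j * det (minor P j) * det Q
  left j = begin
    sign c * M zero c * det (minor M c)
      ≡⟨ cong₂ (λ x y → x * M zero c * y) (sign-↑ˡ j n)
           (det-lowerBlock m (minor M c) λ i l → trans (cong (M (suc i ↑ˡ n)) (punchIn-↑ʳ j l)) (upper≡0 (suc i) l)) ⟩
    sign j * P zero j * (det (λ i l → minor M c (i ↑ˡ n) (l ↑ˡ n)) * det (λ i l → minor M c (m ↑ʳ i) (m ↑ʳ l)))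
      ≡⟨ cong (sign j * P zero j *_) (cong₂ _*_
           (det-cong λ i l → cong (M (suc i ↑ˡ n)) (punchIn-↑ˡ j l))
           (det-cong λ i l → cong (M (suc m ↑ʳ i)) (punchIn-↑ʳ j l))) ⟩
    sign j * P zero j * (det (minor P j) * det Q)
      ≡⟨ ℤ.*-assoc (sign j * P zero j) _ _ ⟨
    sign j * P zero j * det (minor P j) * det Q ∎
    where c = j ↑ˡ n

-- The product has blocks U·Wᵀ, U·Zᵀ, V·Wᵀ and V·Zᵀ; the hypothesis clears the upper right one.
det-stack : ∀ (U : Matrix k (k ℕ.+ l)) (V : Matrix l (k ℕ.+ l)) (W : Matrix k (k ℕ.+ l)) (Z : Matrix l (k ℕ.+ l)) →
            IsZero (U · Z ᵀ) → det ((U ++ V) · (W ++ Z) ᵀ) ≡ det (U · W ᵀ) * det (V · Z ᵀ)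
det-stack {k} {l} U V W Z UZ≡0 = trans
  (det-lowerBlock k ((U ++ V) · (W ++ Z) ᵀ) λ i j → trans (block (lookup-++ˡ U V i) (lookup-++ʳ W Z j)) (UZ≡0 i j))
  (cong₂ _*_ (det-cong λ i j → block (lookup-++ˡ U V i) (lookup-++ˡ W Z j))
             (det-cong λ i j → block (lookup-++ʳ U V i) (lookup-++ʳ W Z j)))
  where
  block : ∀ {u u′ v v′ : Vector ℤ (k ℕ.+ l)} → u ≡ u′ → v ≡ v′ →
          sum (λ x → u x * v x) ≡ sum (λ x → u′ x * v′ x)
  block refl refl = refl

-- Complementary primitive matrices

i*j≡1⇒i≡j : ∀ i j → i * j ≡ 1ℤ → i ≡ j
i*j≡1⇒i≡j i j ij≡1 = go i j (ℕ.m*n≡1⇒m≡1 ∣ i ∣ ∣ j ∣ abs≡1) (ℕ.m*n≡1⇒n≡1 ∣ i ∣ ∣ j ∣ abs≡1) ij≡1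
  where
  abs≡1 : ∣ i ∣ ℕ.* ∣ j ∣ ≡ 1
  abs≡1 = trans (sym (ℤ.abs-* i j)) (cong ∣_∣ ij≡1)
  go : ∀ i j → ∣ i ∣ ≡ 1 → ∣ j ∣ ≡ 1 → i * j ≡ 1ℤ → i ≡ j
  go (ℤ.+ .1)     (ℤ.+ .1)     refl refl _ = refl
  go (ℤ.-[1+ .0 ]) (ℤ.-[1+ .0 ]) refl refl _ = refl
  go (ℤ.+ .1)     (ℤ.-[1+ .0 ]) refl refl ()
  go (ℤ.-[1+ .0 ]) (ℤ.+ .1)     refl refl ()

-- In each of the three products the first stack begins with P and the second ends with P′, so the
-- upper right block is always P·P′ᵀ.
det-complement : ∀ (P Q : Matrix k (k ℕ.+ l)) (P′ Q′ : Matrix l (k ℕ.+ l)) →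
                 P · Q ᵀ ≐ I → P′ · Q′ ᵀ ≐ I → IsZero (P · P′ ᵀ) →
                 det (P · P ᵀ) ≡ det (P′ · P′ ᵀ)
det-complement {k} {l} P Q P′ Q′ PQ≐I P′Q′≐I PP′≡0 = begin
  det (P · P ᵀ)                      ≡⟨ ℤ.*-identityʳ _ ⟨
  det (P · P ᵀ) * 1ℤ                 ≡⟨ cong (det (P · P ᵀ) *_) Q′P′≡1 ⟨
  det (P · P ᵀ) * det (Q′ · P′ ᵀ)    ≡⟨ det-stack P Q′ P P′ PP′≡0 ⟨
  det (N · S ᵀ)                      ≡⟨ det-·ᵀ N S ⟩
  det N * det S                      ≡⟨ ℤ.*-comm (det N) (det S) ⟩
  det S * det N                      ≡⟨ cong (det S *_) N≡T ⟩
  det S * det T                      ≡⟨ det-·ᵀ S T ⟨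
  det (S · T ᵀ)                      ≡⟨ det-stack P P′ Q P′ PP′≡0 ⟩
  det (P · Q ᵀ) * det (P′ · P′ ᵀ)    ≡⟨ cong (_* det (P′ · P′ ᵀ)) PQ≡1 ⟩
  1ℤ * det (P′ · P′ ᵀ)               ≡⟨ ℤ.*-identityˡ _ ⟩
  det (P′ · P′ ᵀ)                    ∎
  where
  N S T : Matrix (k ℕ.+ l) (k ℕ.+ l)
  N = P ++ Q′
  S = P ++ P′
  T = Q ++ P′
  PQ≡1 : det (P · Q ᵀ) ≡ 1ℤ
  PQ≡1 = trans (det-cong PQ≐I) (det-I k)
  Q′P′≡1 : det (Q′ · P′ ᵀ) ≡ 1ℤ
  Q′P′≡1 = begin
    det (Q′ · P′ ᵀ)        ≡⟨ det-cong (ᵀ-· P′ (Q′ ᵀ)) ⟨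
    det ((P′ · Q′ ᵀ) ᵀ)    ≡⟨ det-ᵀ (P′ · Q′ ᵀ) ⟩
    det (P′ · Q′ ᵀ)        ≡⟨ det-cong P′Q′≐I ⟩
    det (I {l})            ≡⟨ det-I l ⟩
    1ℤ                     ∎
  N≡T : det N ≡ det T
  N≡T = i*j≡1⇒i≡j (det N) (det T) (begin
    det N * det T                      ≡⟨ det-·ᵀ N T ⟨
    det (N · T ᵀ)                      ≡⟨ det-stack P Q′ Q P′ PP′≡0 ⟩
    det (P · Q ᵀ) * det (Q′ · P′ ᵀ)    ≡⟨ cong₂ _*_ PQ≡1 Q′P′≡1 ⟩
    1ℤ                                 ∎)

-- Rank

-- Elimination without division: with a pivot p in column 0 of row i, each other row R becomes p R -
-- R₀ Mᵢ, which has one column fewer to treat.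
dependent : n ℕ.< m → (M : Matrix m n) →
            Σ[ c ∈ Vector ℤ m ] (∃[ i ] c i ≢ 0ℤ) × (∀ j → rowCombination c M j ≡ 0ℤ)
dependent {zero}  {suc m} _         M = (λ _ → 1ℤ) , (zero , λ ()) , λ ()
dependent {suc n} {suc m} (s≤s n<m) M with Fin.any? (λ i → ¬? (M i zero ℤ.≟ 0ℤ))
... | no ¬pivot = let c , nonzero , dep = dependent (ℕ.m≤n⇒m≤1+n n<m) (λ i j → M i (suc j)) in
  c , nonzero , λ
    { zero    → sum-zero λ i → trans (cong (c i *_) (decidable-stable (M i zero ℤ.≟ 0ℤ) (λ p → ¬pivot (i , p))))
                                     (ℤ.*-zeroʳ (c i))
    ; (suc j) → dep j }
-- Unfolding a relation c among the reduced rows puts p c_l on the other rows and -s on the pivot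
-- row. It stays nontrivial because p and some c_l are nonzero.
... | yes (i , p≢0) = insertAt (λ l → p * c l) i (- s) , (punchIn i l₀ , nonzero) , combination
  where
  p : ℤ
  p = M i zero
  R : Matrix m (suc n)
  R l = M (punchIn i l)
  reduced : Matrix m (suc n)
  reduced l j = p * R l j - R l zero * M i j
  IH = dependent n<m (λ l j → reduced l (suc j))
  c  = proj₁ IH
  l₀ = proj₁ (proj₁ (proj₂ IH))
  s : ℤ
  s = sum (λ l → c l * R l zero)
  nonzero : insertAt (λ l → p * c l) i (- s) (punchIn i l₀) ≢ 0ℤ
  nonzero eq = [ p≢0 , proj₂ (proj₁ (proj₂ IH)) ]′
    (ℤ.i*j≡0⇒i≡0∨j≡0 p (trans (sym (insertAt-punchIn (λ l → p * c l) i (- s) l₀)) eq))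
  reduced≡0 : ∀ j → rowCombination c reduced j ≡ 0ℤ
  reduced≡0 zero    = sum-zero λ l → vanish p (c l) (R l zero)
    where
    vanish : ∀ p c x → c * (p * x - x * p) ≡ 0ℤ
    vanish = solve-∀
  reduced≡0 (suc j) = proj₂ (proj₂ IH) j
  rearrange : ∀ p c x y z → (p * c) * x ≡ c * (p * x - y * z) + z * (c * y)
  rearrange = solve-∀
  combination : ∀ j → rowCombination (insertAt (λ l → p * c l) i (- s)) M j ≡ 0ℤ
  combination j = begin
    rowCombination c′ M j
      ≡⟨ sum-remove {i = i} (λ x → c′ x * M x j) ⟩
    c′ i * M i j + sum (λ l → c′ (punchIn i l) * R l j)
      ≡⟨ cong₂ (λ x y → x * M i j + y) (insertAt-lookup (λ l → p * c l) i (- s))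
           (sum-cong-≗ λ l → cong (_* R l j) (insertAt-punchIn (λ l → p * c l) i (- s) l)) ⟩
    - s * M i j + sum (λ l → p * c l * R l j)
      ≡⟨ cong (- s * M i j +_) (sum-linear (M i j) {v = λ l → c l * R l zero} λ l → rearrange p (c l) (R l j) (R l zero) (M i j)) ⟩
    - s * M i j + (rowCombination c reduced j + M i j * s)
      ≡⟨ cong (λ z → - s * M i j + (z + M i j * s)) (reduced≡0 j) ⟩
    - s * M i j + (0ℤ + M i j * s)
      ≡⟨ cancel s (M i j) ⟩
    0ℤ ∎
    where
    c′ = insertAt (λ l → p * c l) i (- s)
    cancel : ∀ s x → - s * x + (0ℤ + x * s) ≡ 0ℤ
    cancel = solve-∀

fullRowRank⇒≤ : (M : Matrix m n) → FullRowRank M → m ℕ.≤ n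
fullRowRank⇒≤ M full = ℕ.≮⇒≥ λ n<m →
  let c , (i , c≢0) , dep = dependent n<m M in c≢0 (full c dep i)

det-diagonal≢0 : ∀ (d : Vector ℤ n) → (∀ i → d i ≢ 0ℤ) → {D : Matrix n n} →
                 (∀ i j → D i j ≡ d i * I i j) → det D ≢ 0ℤ
det-diagonal≢0 {suc n} d d≢0 {D} D≡ detD≡0 =
  [ d≢0 zero , det-diagonal≢0 (tail d) (d≢0 ∘ suc) (λ i j → D≡ (suc i) (suc j)) ]′
  (ℤ.i*j≡0⇒i≡0∨j≡0 (d zero) (trans (sym expand) detD≡0))
  where
  minor : Fin (suc n) → Matrix n n
  minor j i l = D (suc i) (punchIn j l)
  D₀ⱼ≡0 : ∀ j → D zero (suc j) ≡ 0ℤ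
  D₀ⱼ≡0 j = trans (D≡ zero (suc j)) (ℤ.*-zeroʳ (d zero))
  expand : det D ≡ d zero * det (minor zero)
  expand = begin
    1ℤ * D zero zero * det (minor zero) + sum (λ j → - sign j * D zero (suc j) * det (minor (suc j)))
      ≡⟨ cong₂ (λ x y → 1ℤ * x * det (minor zero) + y) (trans (D≡ zero zero) (ℤ.*-identityʳ (d zero)))
           (sum-zero λ j → cong (_* det (minor (suc j))) (trans (cong (- sign j *_) (D₀ⱼ≡0 j)) (ℤ.*-zeroʳ (- sign j)))) ⟩
    1ℤ * d zero * det (minor zero) + 0ℤ
      ≡⟨ ℤ.+-identityʳ _ ⟩
    1ℤ * d zero * det (minor zero)
      ≡⟨ cong (_* det (minor zero)) (ℤ.*-identityˡ (d zero)) ⟩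
    d zero * det (minor zero) ∎

-- Each e_j together with the n rows of V is dependent, and independence of V forces a nonzero
-- coefficient on e_j. Collecting these relations gives T with T·V diagonal and nonzero on the
-- diagonal, so T is an inverse of V up to row scaling.
fullRowRank⇒det≢0 : (V : Matrix n n) → FullRowRank V → det V ≢ 0ℤ
fullRowRank⇒det≢0 {n} V full detV≡0 = det-diagonal≢0 d d≢0 TV≡ (begin
  det (T · V)      ≡⟨ det-· T V ⟩
  det T * det V    ≡⟨ cong (det T *_) detV≡0 ⟩
  det T * 0ℤ       ≡⟨ ℤ.*-zeroʳ (det T) ⟩
  0ℤ               ∎)
  where
  dep : ∀ j → Σ[ c ∈ Vector ℤ (suc n) ] (∃[ i ] c i ≢ 0ℤ) × (∀ x → rowCombination c (I j ∷ V) x ≡ 0ℤ)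
  dep j = dependent ℕ.≤-refl (I j ∷ V)
  T : Matrix n n
  T j = tail (proj₁ (dep j))
  d : Vector ℤ n
  d j = - proj₁ (dep j) zero
  solveFor : ∀ a x s → a * x + s ≡ 0ℤ → s ≡ - a * x
  solveFor a x s eq = begin
    s                        ≡⟨ shift a x s ⟩
    (a * x + s) + - a * x    ≡⟨ cong (_+ - a * x) eq ⟩
    0ℤ + - a * x             ≡⟨ ℤ.+-identityˡ (- a * x) ⟩
    - a * x                  ∎
    where
    shift : ∀ a x s → s ≡ (a * x + s) + - a * x
    shift = solve-∀
  TV≡ : ∀ j x → (T · V) j x ≡ d j * I j x
  TV≡ j x = solveFor (proj₁ (dep j) zero) (I j x) _ (proj₂ (proj₂ (dep j)) x)
  d≢0 : ∀ j → d j ≢ 0ℤ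
  d≢0 j dⱼ≡0 = proj₂ (proj₁ (proj₂ (dep j))) (all≡0 (proj₁ (proj₁ (proj₂ (dep j)))))
    where
    all≡0 : ∀ i → proj₁ (dep j) i ≡ 0ℤ
    all≡0 zero    = ℤ.neg-injective dⱼ≡0
    all≡0 (suc i) = full (T j) (λ x → trans (TV≡ j x) (cong (_* I j x) dⱼ≡0)) i

-- Each row of X - Y is a relation among the rows of V.
fullRowRank-cancel : {V : Matrix r n} → FullRowRank V → ∀ {X Y : Matrix m r} → X · V ≐ Y · V → X ≐ Y
fullRowRank-cancel {V = V} full {X} {Y} XV≐YV i j = ℤ.i-j≡0⇒i≡j (X i j) (Y i j)
  (full (λ x → X i x - Y i x) difference j)
  where
  distrib : ∀ x y v → (x - y) * v ≡ x * v + -1ℤ * (y * v)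
  distrib = solve-∀
  difference : ∀ z → sum (λ x → (X i x - Y i x) * V x z) ≡ 0ℤ
  difference z = begin
    sum (λ x → (X i x - Y i x) * V x z)    ≡⟨ sum-linear -1ℤ (λ x → distrib (X i x) (Y i x) (V x z)) ⟩
    (X · V) i z + -1ℤ * (Y · V) i z        ≡⟨ cong₂ _+_ (XV≐YV i z) (ℤ.-1*i≡-i ((Y · V) i z)) ⟩
    (Y · V) i z - (Y · V) i z              ≡⟨ ℤ.+-inverseʳ ((Y · V) i z) ⟩
    0ℤ                                     ∎

IsZero-·ʳ : ∀ (Z : Matrix l m) (N : Matrix m n) → IsZero Z → IsZero (Z · N)
IsZero-·ʳ Z N Z≡0 i j = sum-zero λ x → cong (_* N x j) (Z≡0 i x)

IsZero-·ˡ : ∀ (M : Matrix l m) (Z : Matrix m n) → IsZero Z → IsZero (M · Z)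
IsZero-·ˡ M Z Z≡0 i j = sum-zero λ x → trans (cong (M i x *_) (Z≡0 x j)) (ℤ.*-zeroʳ (M i x))

-- A relation among the rows of X persists after multiplication by Y.
fullRowRank-factorˡ : {M : Matrix m n} (X : Matrix m r) (Y : Matrix r n) → M ≐ X · Y →
                      FullRowRank M → FullRowRank X
fullRowRank-factorˡ {M = M} X Y M≐XY full c cX≡0 = full c λ j → begin
  rowCombination c M j            ≡⟨ ·-cong {M = C} (λ _ _ → refl) M≐XY zero j ⟩
  (C · (X · Y)) zero j            ≡⟨ ·-assoc C X Y zero j ⟨
  ((C · X) · Y) zero j            ≡⟨ IsZero-·ʳ (C · X) Y (λ _ → cX≡0) zero j ⟩
  0ℤ                              ∎
  where
  C : Matrix 1 _
  C _ = c

-- Lattice bases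

rowLattice⊆⇒factor : (M : Matrix m n) (V : Matrix r n) → rowLattice M ⊆ rowLattice V →
                     Σ[ X ∈ Matrix m r ] M ≐ X · V
rowLattice⊆⇒factor M V M⊆V = (λ i → proj₁ (factor i)) , (λ i → proj₂ (factor i))
  where
  factor : ∀ i → M i ∈ rowLattice V
  factor i = M⊆V (I i , λ j → sym (·-identityˡ M i j))

-- X writes the generators in the basis and Y the basis in the generators, so Y·X·V = Y·M = V, and V
-- cancels. Applied to a transpose, this Y is the source of the right inverses.
basis-factors : {V : Matrix r n} {M : Matrix m n} → IsBasis V (rowLattice M) →
                Σ[ X ∈ Matrix m r ] Σ[ Y ∈ Matrix r m ] M ≐ X · V × V ≐ Y · M × Y · X ≐ I
basis-factors {V = V} {M} (⇔V , full) = X , Y , M≐XV , V≐YM , fullRowRank-cancel full YXV≐V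
  where
  factorM = rowLattice⊆⇒factor M V (λ {v} → Equivalence.to (⇔V v))
  factorV = rowLattice⊆⇒factor V M (λ {v} → Equivalence.from (⇔V v))
  X = proj₁ factorM
  Y = proj₁ factorV
  M≐XV = proj₂ factorM
  V≐YM = proj₂ factorV
  YXV≐V : (Y · X) · V ≐ I · V
  YXV≐V i j = begin
    ((Y · X) · V) i j    ≡⟨ ·-assoc Y X V i j ⟩
    (Y · (X · V)) i j    ≡⟨ ·-cong {M = Y} (λ _ _ → refl) M≐XV i j ⟨
    (Y · M) i j          ≡⟨ V≐YM i j ⟨
    V i j                ≡⟨ ·-identityˡ V i j ⟨
    (I · V) i j          ∎

-- Y inherits full row rank from V and X from M, which bounds r and k by each other.
basis-change : {V : Matrix r n} {M : Matrix k n} → FullRowRank M → IsBasis V (rowLattice M) →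
               r ≡ k × Σ[ X ∈ Matrix k r ] Σ[ Y ∈ Matrix r k ] V ≐ Y · M × Y · X ≐ I
basis-change {V = V} {M} fullM basis@(_ , fullV) with basis-factors basis
... | X , Y , M≐XV , V≐YM , YX≐I =
  ℕ.≤-antisym (fullRowRank⇒≤ Y (fullRowRank-factorˡ Y M V≐YM fullV)) (fullRowRank⇒≤ X (fullRowRank-factorˡ X V M≐XV fullM)) ,
  X , Y , V≐YM , YX≐I

-- Gram determinants and change of basis

sandwich : ∀ (U : Matrix k l) (P : Matrix l n) (U′ : Matrix m r) (P′ : Matrix r n) →
           (U · P) · (U′ · P′) ᵀ ≐ (U · (P · P′ ᵀ)) · U′ ᵀ
sandwich U P U′ P′ i j = begin
  ((U · P) · (U′ · P′) ᵀ) i j        ≡⟨ ·-cong {M = U · P} (λ _ _ → refl) (ᵀ-· U′ P′) i j ⟩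
  ((U · P) · (P′ ᵀ · U′ ᵀ)) i j      ≡⟨ ·-assoc (U · P) (P′ ᵀ) (U′ ᵀ) i j ⟨
  (((U · P) · P′ ᵀ) · U′ ᵀ) i j      ≡⟨ ·-cong {N = U′ ᵀ} (·-assoc U P (P′ ᵀ)) (λ _ _ → refl) i j ⟩
  ((U · (P · P′ ᵀ)) · U′ ᵀ) i j      ∎

gram-· : {M : Matrix k n} (U : Matrix k k) (P : Matrix k n) → M ≐ U · P →
         det (M · M ᵀ) ≡ det U * det U * det (P · P ᵀ)
gram-· {M = M} U P M≐UP = begin
  det (M · M ᵀ)                      ≡⟨ det-cong (·-cong M≐UP (λ i j → M≐UP j i)) ⟩
  det ((U · P) · (U · P) ᵀ)          ≡⟨ det-cong (sandwich U P U P) ⟩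
  det ((U · (P · P ᵀ)) · U ᵀ)        ≡⟨ det-·ᵀ (U · (P · P ᵀ)) U ⟩
  det (U · (P · P ᵀ)) * det U        ≡⟨ cong (_* det U) (det-· U (P · P ᵀ)) ⟩
  det U * det (P · P ᵀ) * det U      ≡⟨ rearrange (det U) (det (P · P ᵀ)) ⟩
  det U * det U * det (P · P ᵀ)      ∎
  where
  rearrange : ∀ u g → u * g * u ≡ u * u * g
  rearrange = solve-∀

-- Independence of det L from the basis: Y·X = I makes det Y a unit equal to det X, so the square of
-- det Y is 1.
gram-basis : {V : Matrix r n} {M : Matrix k n} → FullRowRank M → IsBasis V (rowLattice M) →
             det (V · V ᵀ) ≡ det (M · M ᵀ)
gram-basis {r = r} {V = V} {M} full basis with basis-change full basis
... | refl , X , Y , V≐YM , YX≐I = begin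
  det (V · V ᵀ)                    ≡⟨ gram-· Y M V≐YM ⟩
  det Y * det Y * det (M · M ᵀ)    ≡⟨ cong (λ z → det Y * z * det (M · M ᵀ)) (i*j≡1⇒i≡j (det Y) (det X) YX≡1) ⟩
  det Y * det X * det (M · M ᵀ)    ≡⟨ cong (_* det (M · M ᵀ)) YX≡1 ⟩
  1ℤ * det (M · M ᵀ)               ≡⟨ ℤ.*-identityˡ _ ⟩
  det (M · M ᵀ)                    ∎
  where
  YX≡1 : det Y * det X ≡ 1ℤ
  YX≡1 = trans (sym (det-· Y X)) (trans (det-cong YX≐I) (det-I r))

-- Factoring out the column lattice

record PrimitiveFactor {k n} (M : Matrix k n) (c : ℝ) : Set where
  field
    W   : Matrix k k
    P Q : Matrix k n
    fullW  : FullRowRank W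
    M≐WᵀP  : M ≐ W ᵀ · P
    PQᵀ≐I  : P · Q ᵀ ≐ I
    c≈     : c ≈ √ (det W * det W)

primitiveFactor : {M : Matrix k n} {c : ℝ} → FullRowRank M → IsDet (colLattice M) c → PrimitiveFactor M c
primitiveFactor {k} {n} {M} {c} full (r , V , basis , c≈) with basis-factors basis
... | X , Y , Mᵀ≐XV , V≐YMᵀ , YX≐I = square r≡k V (proj₂ basis) X Y M≐VᵀXᵀ YX≐I c≈
  where
  M≐VᵀXᵀ : M ≐ V ᵀ · X ᵀ
  M≐VᵀXᵀ i j = trans (Mᵀ≐XV j i) (ᵀ-· X V i j)
  r≡k : r ≡ k
  -- The k columns of V bound r from above; the full row rank of M, inherited by Vᵀ, bounds it from
  -- below.
  r≡k = ℕ.≤-antisym (fullRowRank⇒≤ V (proj₂ basis)) (fullRowRank⇒≤ (V ᵀ) (fullRowRank-factorˡ (V ᵀ) (X ᵀ) M≐VᵀXᵀ full))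
  square : ∀ {r} → r ≡ k → (V : Matrix r k) → FullRowRank V → (X : Matrix n r) (Y : Matrix r n) →
           M ≐ V ᵀ · X ᵀ → Y · X ≐ I → c ≈ √ det (V · V ᵀ) → PrimitiveFactor M c
  square refl V fullV X Y M≐VᵀXᵀ YX≐I c≈ = record
    { W = V ; P = X ᵀ ; Q = Y ; fullW = fullV ; M≐WᵀP = M≐VᵀXᵀ
    ; PQᵀ≐I = λ i j → trans (sym (ᵀ-· Y X i j)) (trans (YX≐I j i) (I-symmetric i j))
    ; c≈ = subst (λ z → c ≈ √ z) (det-·ᵀ V V) c≈
    }

open PrimitiveFactor

primitive-gram : {M : Matrix k n} {c : ℝ} (F : PrimitiveFactor M c) →
                 det (M · M ᵀ) ≡ det (W F) * det (W F) * det (P F · P F ᵀ)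
primitive-gram {M = M} F = begin
  det (M · M ᵀ)
    ≡⟨ gram-· (W F ᵀ) (P F) (M≐WᵀP F) ⟩
  det (W F ᵀ) * det (W F ᵀ) * det (P F · P F ᵀ)
    ≡⟨ cong (λ z → z * z * det (P F · P F ᵀ)) (det-ᵀ (W F)) ⟩
  det (W F) * det (W F) * det (P F · P F ᵀ) ∎

-- From Wᵀ·(P·P′ᵀ)·W′ = 0, independence of the rows of W′ cancels on the right. Each column of P·P′ᵀ
-- is then a relation among the rows of W.
primitive-orthogonal : {M : Matrix k n} {N : Matrix l n} {c d : ℝ}
                       (F : PrimitiveFactor M c) (G : PrimitiveFactor N d) →
                       IsZero (M · N ᵀ) → IsZero (P F · P G ᵀ)
primitive-orthogonal {M = M} {N} F G MN≡0 i j = fullW F (λ x → (P F · P G ᵀ) x j) column≡0 i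
  where
  WᵀPP′≡0 : W F ᵀ · (P F · P G ᵀ) ≐ λ _ _ → 0ℤ
  WᵀPP′≡0 = fullRowRank-cancel (fullW G) λ i j → begin
    ((W F ᵀ · (P F · P G ᵀ)) · W G) i j       ≡⟨ sandwich (W F ᵀ) (P F) (W G ᵀ) (P G) i j ⟨
    ((W F ᵀ · P F) · (W G ᵀ · P G) ᵀ) i j     ≡⟨ ·-cong (M≐WᵀP F) (λ x y → M≐WᵀP G y x) i j ⟨
    (M · N ᵀ) i j                             ≡⟨ MN≡0 i j ⟩
    0ℤ                                        ≡⟨ IsZero-·ʳ (λ _ _ → 0ℤ) (W G) (λ _ _ → refl) i j ⟨
    ((λ _ _ → 0ℤ) · W G) i j                  ∎
  column≡0 : ∀ y → sum (λ x → (P F · P G ᵀ) x j * W F x y) ≡ 0ℤ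
  column≡0 y = trans (sum-cong-≗ λ x → ℤ.*-comm ((P F · P G ᵀ) x j) (W F x y)) (WᵀPP′≡0 y j)

-- The width stays a variable with an equation, so that matching on `refl` turns it into k + l; in
-- the theorem l is n ∸ k.
primitive-complement : ∀ {k l n} → n ≡ k ℕ.+ l → {M : Matrix k n} {N : Matrix l n} {c d : ℝ}
                       (F : PrimitiveFactor M c) (G : PrimitiveFactor N d) →
                       IsZero (M · N ᵀ) → det (P F · P F ᵀ) ≡ det (P G · P G ᵀ)
primitive-complement refl F G MN≡0 =
  det-complement (P F) (Q F) (P G) (Q G) (PQᵀ≐I F) (PQᵀ≐I G) (primitive-orthogonal F G MN≡0)

primitive-quotient : {M : Matrix k n} {c : ℝ} (F : PrimitiveFactor M c) → ∀ x → x ≈ √ det (M · M ᵀ) →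
                     ∀ (c#0 : c #0) → x / c ⟨ c#0 ⟩ ≈ √ det (P F · P F ᵀ)
primitive-quotient {c = c} F x x≈ = √-quotient (det (W F)) (fullRowRank⇒det≢0 (W F) (fullW F)) c (c≈ F) x
  (det (P F · P F ᵀ)) (subst (λ z → x ≈ √ z) (primitive-gram F) x≈)

primitive-#0 : {M : Matrix k n} {c : ℝ} → PrimitiveFactor M c → c #0
primitive-#0 {c = c} F = √-square-#0 (det (W F)) (fullRowRank⇒det≢0 (W F) (fullW F)) c (c≈ F)

-- `IsNdet` may use any basis M of L_R(A). The matrix Y with M = Y·A is returned so that
-- orthogonality can be carried over from A to M.
ndet-primitive : {A : Matrix k n} {α : ℝ} → FullRowRank A → IsNdet (rowLattice A) α →
                 Σ[ Y ∈ Matrix k k ] Σ[ M ∈ Matrix k n ] Σ[ c ∈ ℝ ] M ≐ Y · A ×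
                   (Σ[ F ∈ PrimitiveFactor M c ] α ≈ √ det (P F · P F ᵀ))
ndet-primitive {A = A} {α} full (r , M , basis , d , c , (_ , V , basisV , d≈) , detc , c#0 , α≈d/c)
  with basis-change full basis
... | refl , _ , Y , M≐YA , _ = Y , M , c , M≐YA , F ,
  ~-trans (seq α) (seq (d / c ⟨ c#0 ⟩)) (seq (√ det (P F · P F ᵀ))) α≈d/c
    -- The value `d` may come from yet another basis V of the same lattice; `gram-basis` brings it
    -- back to M.
    (primitive-quotient F d (subst (λ z → d ≈ √ z) (gram-basis (proj₂ basis) basisV) d≈) c#0)
  where
  F : PrimitiveFactor M c
  F = primitiveFactor (proj₂ basis) detc

theorem2p5 : ∀ {k n : ℕ} → 0 < k → k < n →
    (A : Matrix k n) (B : Matrix (n ∸ k) n) →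
    FullRowRank A → FullRowRank B → IsZero (A · B ᵀ) →
    (∀ α β → IsNdet (rowLattice A) α → IsNdet (rowLattice B) β → α ≈ β)
    ×
    (∀ c d → IsDet (colLattice A) c → IsDet (colLattice B) d →
    Σ[ c#0 ∈ c #0 ] Σ[ d#0 ∈ d #0 ]
    √ det (A · A ᵀ) / c ⟨ c#0 ⟩ ≈ √ det (B · B ᵀ) / d ⟨ d#0 ⟩)
theorem2p5 {k} {n} _ k<n A B fullA fullB AB≡0 = ndets , quotients
  where
  n≡k+l : n ≡ k ℕ.+ (n ∸ k)
  n≡k+l = sym (ℕ.m+[n∸m]≡n (ℕ.<⇒≤ k<n))

  via : ∀ (x y : ℝ) {g h : ℤ} → g ≡ h → x ≈ √ g → y ≈ √ h → x ≈ y
  via x y {g} refl x≈ y≈ = ~-trans (seq x) (seq (√ g)) (seq y) x≈ (~-sym (seq y) (seq (√ g)) y≈)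

  ndets : ∀ α β → IsNdet (rowLattice A) α → IsNdet (rowLattice B) β → α ≈ β
  ndets α β ndetα ndetβ
    with ndet-primitive {A = A} {α} fullA ndetα | ndet-primitive {A = B} {β} fullB ndetβ
  ... | Y , M , _ , M≐YA , F , α≈ | Z , N , _ , N≐ZB , G , β≈ =
    via α β (primitive-complement n≡k+l F G MN≡0) α≈ β≈
    where
    MN≡0 : IsZero (M · N ᵀ)
    MN≡0 i j = begin
      (M · N ᵀ) i j                    ≡⟨ ·-cong M≐YA (λ x y → N≐ZB y x) i j ⟩
      ((Y · A) · (Z · B) ᵀ) i j        ≡⟨ sandwich Y A Z B i j ⟩
      ((Y · (A · B ᵀ)) · Z ᵀ) i j      ≡⟨ IsZero-·ʳ (Y · (A · B ᵀ)) (Z ᵀ) (IsZero-·ˡ Y (A · B ᵀ) AB≡0) i j ⟩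
      0ℤ                               ∎

  quotients : ∀ c d → IsDet (colLattice A) c → IsDet (colLattice B) d →
              Σ[ c#0 ∈ c #0 ] Σ[ d#0 ∈ d #0 ]
                √ det (A · A ᵀ) / c ⟨ c#0 ⟩ ≈ √ det (B · B ᵀ) / d ⟨ d#0 ⟩
  -- Here A and B are factored themselves, so orthogonality is the hypothesis as given.
  quotients c d detc detd = primitive-#0 F , primitive-#0 G ,
    via (√ det (A · A ᵀ) / c ⟨ primitive-#0 F ⟩) (√ det (B · B ᵀ) / d ⟨ primitive-#0 G ⟩)
        (primitive-complement n≡k+l F G AB≡0)
        (primitive-quotient F (√ det (A · A ᵀ)) (≗⇒~ {√A} {√A} λ _ → refl) (primitive-#0 F))
        (primitive-quotient G (√ det (B · B ᵀ)) (≗⇒~ {√B} {√B} λ _ → refl) (primitive-#0 G))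
    where
    F : PrimitiveFactor A c
    F = primitiveFactor fullA detc
    G : PrimitiveFactor B d
    G = primitiveFactor fullB detd
    √A √B : ℕ → ℚ
    √A = seq (√ det (A · A ᵀ))
    √B = seq (√ det (B · B ᵀ))
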